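{- No two non-isomorphic squids have the same chromatic symmetric function.
   Context: All graphs are finite and simple. A unicyclic graph is a graph containing exactly one cycle. A squid is a connected unicyclic graph having exactly one vertex of degree greater than 2. For a graph $G$, the chromatic symmetric function is ${\mathbf X}_G=\sum_\kappa\prod_{v\in V(G)}x_{\kappa(v)}$, summed over all proper colorings $\kappa:V(G)\to\{1,2,\dots\}$ (adjacent vertices receive distinct colors), in commuting indeterminates $x_1,x_2,\dots$. -}

module Defs where

open import Data.Nat using (ℕ; zero; suc; _+_; _≤_; _<_)
open import Data.Bool using (Bool; true; false; if_then_else_; _∧_; not)
open import Data.Fin using (Fin)
import Data.Fin as Fin
open import Data.List using (List; []; _∷_; _++_; length; map; allFin; concatMap)
open import Data.Nat.ListAction using (sum)
open import Data.List.Relation.Unary.Linked using (Linked)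
open import Data.List.Relation.Unary.Unique.Propositional using (Unique)
open import Data.Vec using (Vec; lookup)
import Data.Vec as Vec
open import Data.Product using (Σ; ∃; ∃-syntax; _×_; _,_)
open import Data.Sum using (_⊎_)
open import Relation.Binary.PropositionalEquality using (_≡_)
open import Relation.Nullary.Decidable using (⌊_⌋)
open import Function.Bundles using (_↔_; Inverse)

record Graph (n : ℕ) : Set where
  field
    adj   : Fin n → Fin n → Bool
    sym   : ∀ u v → adj u v ≡ adj v u
    irrefl : ∀ v → adj v v ≡ false
open Graph public

Adj : ∀ {n} → Graph n → Fin n → Fin n → Set
Adj G u v = adj G u v ≡ true

countB : ∀ {n} → (Fin n → Bool) → ℕ
countB {n} P = sum (map (λ w → if P w then 1 else 0) (allFin n))

degree : ∀ {n} → Graph n → Fin n → ℕ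
degree G v = countB (adj G v)

data Walk {n} (G : Graph n) : Fin n → Fin n → Set where
  here : ∀ {v} → Walk G v v
  step : ∀ {u v w} → Adj G u v → Walk G v w → Walk G u w

Connected : ∀ {n} → Graph n → Set
Connected G = ∀ u v → Walk G u v

record Cycle {n} (G : Graph n) : Set where
  field
    start : Fin n
    rest  : List (Fin n)
    long  : 2 ≤ length rest
    distinct : Unique (start ∷ rest)
    closed   : Linked (Adj G) (start ∷ rest ++ start ∷ [])
open Cycle public

Consec : ∀ {n} → List (Fin n) → Fin n → Fin n → Set
Consec l u w = ∃[ xs ] ∃[ ys ] (l ≡ xs ++ u ∷ w ∷ ys)

CycleEdge : ∀ {n} {G : Graph n} → Cycle G → Fin n → Fin n → Set
CycleEdge c u w =
  Consec (start c ∷ rest c ++ start c ∷ []) u w ⊎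
  Consec (start c ∷ rest c ++ start c ∷ []) w u

SameCycle : ∀ {n} {G : Graph n} → Cycle G → Cycle G → Set
SameCycle c d = ∀ u w → (CycleEdge c u w → CycleEdge d u w) × (CycleEdge d u w → CycleEdge c u w)

Unicyclic : ∀ {n} → Graph n → Set
Unicyclic G = Cycle G × (∀ (c d : Cycle G) → SameCycle c d)

Squid : ∀ {n} → Graph n → Set
Squid G = Connected G × Unicyclic G ×
  (∃[ v ] (2 < degree G v × (∀ w → 2 < degree G w → w ≡ v)))

_≅_ : ∀ {n m} → Graph n → Graph m → Set
_≅_ {n} {m} G H = Σ (Fin n ↔ Fin m) λ f →
  ∀ u v → adj H (Inverse.to f u) (Inverse.to f v) ≡ adj G u v

-- Chromatic symmetric function, represented by its coefficients.
-- A monomial x_1^{a_1} ... x_k^{a_k} is given by the exponent list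
-- (a_1 , ... , a_k) (later variables have exponent 0). Its coefficient in
-- X_G is the number of proper colourings κ : V → {1..k} with
-- |κ⁻¹(i)| = a_i for every i.

allVecs : (k n : ℕ) → List (Vec (Fin k) n)
allVecs k zero = Vec.[] ∷ []
allVecs k (suc n) = concatMap (λ i → map (i Vec.∷_) (allVecs k n)) (allFin k)

allB : ∀ {n} → (Fin n → Bool) → Bool
allB {n} P = Data.List.foldr (λ w b → P w ∧ b) true (allFin n)

properB : ∀ {n k} → Graph n → Vec (Fin k) n → Bool
properB G κ = allB (λ u → allB (λ v →
  if adj G u v then not ⌊ lookup κ u Fin.≟ lookup κ v ⌋ else true))

eqℕ : ℕ → ℕ → Bool
eqℕ a b = ⌊ a Data.Nat.≟ b ⌋

sizesB : ∀ {n} (a : List ℕ) → Vec (Fin (length a)) n → Bool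
sizesB {n} a κ = allB {length a} (λ i →
  eqℕ (countB (λ u → ⌊ lookup κ u Fin.≟ i ⌋)) (Data.List.lookup a i))

X : ∀ {n} → Graph n → List ℕ → ℕ
X {n} G a = sum (map (λ κ → if properB G κ ∧ sizesB a κ then 1 else 0)
                     (allVecs (length a) n))

SameX : ∀ {n m} → Graph n → Graph m → Set
SameX G H = ∀ (a : List ℕ) → X G a ≡ X H a

{-# OPTIONS --safe #-}

-- Colour a squid with two groups of q colours each. For fixed k, the number of proper colourings in which
-- exactly k vertices receive a colour of the first group is a combination of coefficients of X. It is
-- divisible by q. Modulo q², only colourings using a single group contribute; this yields the number of
-- vertices and the girth. Modulo q³, the next term counts the ways to cut the vertex set into connected
-- parts of sizes k and n - k. Cuts through the cycle depend only on n and the girth, so the numbers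
-- t k + t (n - k) are determined, where t j counts the tentacles of length at least j. As the cycle has at
-- least three vertices, this folded sequence determines t, hence the tentacle lengths.
-- All congruences hold for every q, so they give equalities of integers.
module Submission where

open import Defs hiding (sym)
import Algebra.Properties.AbelianGroup
open import Data.Bool as Bool using (Bool; true; false; if_then_else_; _∧_; not)
open import Data.Fin as Fin using (Fin; zero; suc)
import Data.Fin.Properties as Finₚ
open import Data.Integer as ℤ using (ℤ; _+_; _*_; _-_; -_; 0ℤ; 1ℤ; -1ℤ)
import Data.Integer.Properties as ℤₚ
open import Data.Integer.Tactic.RingSolver using (solve-∀)
open import Data.List using (List; []; _∷_; _++_; [_]; length; map; allFin; concatMap; concat; upTo; tabulate)
import Data.List.Properties as Listₚ
open import Data.List.Membership.Propositional using (_∈_; _∉_)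
open import Data.List.Membership.Propositional.Properties
  using (∈-map⁺; ∈-map⁻; ∈-++⁺ˡ; ∈-++⁺ʳ; ∈-++⁻; ∈-∃++; ∈-allFin; ∈-upTo⁺; ∈-concatMap⁺; ∈-concatMap⁻; ∈-concat⁺′; ∈-concat⁻′)
open import Data.List.Membership.Propositional.Properties.WithK using (unique∧set⇒bag)
open import Data.List.Relation.Binary.BagAndSetEquality using (∼bag⇒↭)
open import Data.List.Relation.Binary.Permutation.Propositional as ↭ using (_↭_; ↭-sym; ↭⇒↭ₛ)
import Data.List.Relation.Binary.Permutation.Propositional.Properties as ↭ₚ
import Data.List.Relation.Binary.Permutation.Setoid.Properties as ↭ₛₚ
open import Data.List.Relation.Unary.All as All using (All; []; _∷_)
import Data.List.Relation.Unary.All.Properties as Allₚ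
open import Data.List.Relation.Unary.AllPairs using ([]; _∷_)
open import Data.List.Relation.Unary.Any as Any using (here; there)
open import Data.List.Relation.Unary.Linked using (Linked; [-]; _∷_)
open import Data.List.Relation.Unary.Unique.Propositional using (Unique)
import Data.List.Relation.Unary.Unique.Propositional.Properties as Uniqueₚ
open import Data.Nat as ℕ using (ℕ; zero; suc; _≤_; _<_; z≤n; s≤s)
open import Data.Nat.ListAction using (sum)
open import Data.Nat.ListAction.Properties using (sum-↭; sum-++)
import Data.Nat.Properties as ℕₚ
import Data.Nat.Tactic.RingSolver as ℕ-Solver
open import Data.Product using (∃; ∃-syntax; _×_; _,_; proj₁; proj₂)
open import Data.Sum as Sum using (_⊎_; inj₁; inj₂; [_,_]′)
open import Data.Vec as Vec using (Vec; lookup; toList)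
import Data.Vec.Properties as Vecₚ
open import Function using (_∘_; id; mk⇔; mk↔ₛ′)
open import Relation.Binary.PropositionalEquality using (_≡_; _≢_; refl; sym; trans; cong; cong₂; subst; subst₂; setoid; module ≡-Reasoning)
open import Relation.Nullary using (¬_; Dec; yes; no; contradiction)
open import Relation.Nullary.Decidable using (⌊_⌋; _×-dec_; ¬?; isYes≗does; dec-true; dec-false)

-- The choice of colours comes from the power-sum basis. Giving q colours the weight x and q colours
-- the weight y sends p_k to q(x^k + y^k), so the power of q counts the parts of a power-sum term,
-- and the order q² sees exactly the products p_k p_(n-k). That basis is never formed here; the
-- counts themselves are expanded in q. The mechanism is local: next to a coloured vertex there are
-- q - 1 colours of its own group and q of the other, so a change of group along an edge costs a
-- factor q, while staying contributes q - 1, which is -1 modulo q. A single change on a tentacle is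
-- a cut of one edge there. The changes around the cycle are collected in a term that sees the
-- tentacles only through their total length, so this term cancels in the comparison of two squids.
-- The obstacle is that the two groups are interchangeable: a piece of size k cannot be told from
-- its complement, and only folded sums can be read off.

private
  variable
    A B C : Set

-- Finite sums and words

∑ : List A → (A → ℤ) → ℤ
∑ []       F = 0ℤ
∑ (x ∷ xs) F = F x + ∑ xs F

syntax ∑ xs (λ x → e) = ∑[ x ← xs ] e

⟦_⟧ : Bool → ℤ
⟦ b ⟧ = if b then 1ℤ else 0ℤ

⟦∧⟧ : ∀ a b → ⟦ a ∧ b ⟧ ≡ ⟦ a ⟧ * ⟦ b ⟧
⟦∧⟧ true  b = sym (ℤₚ.*-identityˡ _)
⟦∧⟧ false b = refl

∑-cong∈ : (xs : List A) {F F′ : A → ℤ} → (∀ {x} → x ∈ xs → F x ≡ F′ x) → ∑ xs F ≡ ∑ xs F′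
∑-cong∈ []       eq = refl
∑-cong∈ (x ∷ xs) eq = cong₂ _+_ (eq (here refl)) (∑-cong∈ xs (eq ∘ there))

∑-cong : (xs : List A) {F F′ : A → ℤ} → (∀ x → F x ≡ F′ x) → ∑ xs F ≡ ∑ xs F′
∑-cong xs eq = ∑-cong∈ xs (λ {x} _ → eq x)

∑-zero : (xs : List A) → ∑ xs (λ _ → 0ℤ) ≡ 0ℤ
∑-zero []       = refl
∑-zero (x ∷ xs) = trans (ℤₚ.+-identityˡ _) (∑-zero xs)

∑-+ : (xs : List A) (F F′ : A → ℤ) → ∑ xs (λ x → F x + F′ x) ≡ ∑ xs F + ∑ xs F′
∑-+ []       F F′ = refl
∑-+ (x ∷ xs) F F′ rewrite ∑-+ xs F F′ = interchange (F x) (F′ x) (∑ xs F) (∑ xs F′)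
  where
  interchange : ∀ a b c d → a + b + (c + d) ≡ a + c + (b + d)
  interchange = solve-∀

∑-*ˡ : (k : ℤ) (xs : List A) (F : A → ℤ) → ∑ xs (λ x → k * F x) ≡ k * ∑ xs F
∑-*ˡ k []       F = sym (ℤₚ.*-zeroʳ k)
∑-*ˡ k (x ∷ xs) F rewrite ∑-*ˡ k xs F = sym (ℤₚ.*-distribˡ-+ k (F x) (∑ xs F))

∑-++ : (xs ys : List A) (F : A → ℤ) → ∑ (xs ++ ys) F ≡ ∑ xs F + ∑ ys F
∑-++ []       ys F = sym (ℤₚ.+-identityˡ _)
∑-++ (x ∷ xs) ys F rewrite ∑-++ xs ys F = sym (ℤₚ.+-assoc (F x) (∑ xs F) (∑ ys F))

∑-map : (g : A → B) (xs : List A) (F : B → ℤ) → ∑ (map g xs) F ≡ ∑ xs (F ∘ g)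
∑-map g []       F = refl
∑-map g (x ∷ xs) F = cong (F (g x) +_) (∑-map g xs F)

∑-concatMap : (g : A → List B) (xs : List A) (F : B → ℤ) →
  ∑ (concatMap g xs) F ≡ ∑[ x ← xs ] ∑ (g x) F
∑-concatMap g []       F = refl
∑-concatMap g (x ∷ xs) F = trans (∑-++ (g x) (concatMap g xs) F) (cong (∑ (g x) F +_) (∑-concatMap g xs F))

∑-swap : (xs : List A) (ys : List B) (F : A → B → ℤ) →
  ∑[ x ← xs ] ∑[ y ← ys ] F x y ≡ ∑[ y ← ys ] ∑[ x ← xs ] F x y
∑-swap []       ys F = sym (∑-zero ys)
∑-swap (x ∷ xs) ys F rewrite ∑-swap xs ys F = sym (∑-+ ys (F x) (λ y → ∑ xs (λ x → F x y)))

∑-↭ : {xs ys : List A} (F : A → ℤ) → xs ↭ ys → ∑ xs F ≡ ∑ ys F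
∑-↭ F ↭.refl         = refl
∑-↭ F (↭.prep x p)   = cong (F x +_) (∑-↭ F p)
∑-↭ F (↭.swap {xs} x y p) rewrite ∑-↭ F p = exchange (F x) (F y) _
  where
  exchange : ∀ a b c → a + (b + c) ≡ b + (a + c)
  exchange = solve-∀
∑-↭ F (↭.trans p q)  = trans (∑-↭ F p) (∑-↭ F q)

∑-single : {xs : List A} {a : A} (F : A → ℤ) → Unique xs → a ∈ xs →
  (∀ {x} → x ≢ a → F x ≡ 0ℤ) → ∑ xs F ≡ F a
∑-single {xs = x ∷ xs} F (x∉ ∷ u) (here refl) z = begin
  F x + ∑ xs F           ≡⟨ cong (F x +_) (∑-cong∈ xs (λ y∈ → z (λ e → All.lookup x∉ y∈ (sym e)))) ⟩
  F x + ∑ xs (λ _ → 0ℤ)  ≡⟨ cong (F x +_) (∑-zero xs) ⟩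
  F x + 0ℤ               ≡⟨ ℤₚ.+-identityʳ _ ⟩
  F x                    ∎
  where open ≡-Reasoning
∑-single {xs = x ∷ xs} {a} F (x∉ ∷ u) (there a∈) z = begin
  F x + ∑ xs F  ≡⟨ cong₂ _+_ (z (All.lookup x∉ a∈)) (∑-single F u a∈ z) ⟩
  0ℤ + F a      ≡⟨ ℤₚ.+-identityˡ (F a) ⟩
  F a           ∎
  where open ≡-Reasoning

pos-sum : (f : A → ℕ) (xs : List A) → ℤ.+ sum (map f xs) ≡ ∑[ x ← xs ] (ℤ.+ f x)
pos-sum f []       = refl
pos-sum f (x ∷ xs) = cong (ℤ.+ f x +_) (pos-sum f xs)

pos-indicator : ∀ b → ℤ.+ (if b then 1 else 0) ≡ ⟦ b ⟧
pos-indicator true  = refl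
pos-indicator false = refl

words : List A → ℕ → List (List A)
words xs zero    = [ [] ]
words xs (suc n) = concatMap (λ x → map (x ∷_) (words xs n)) xs

∑-words-suc : (xs : List A) (n : ℕ) (F : List A → ℤ) →
  ∑ (words xs (suc n)) F ≡ ∑[ x ← xs ] ∑[ w ← words xs n ] F (x ∷ w)
∑-words-suc xs n F = trans (∑-concatMap _ xs F) (∑-cong xs (λ x → ∑-map (x ∷_) (words xs n) F))

∑-words-+ : (xs : List A) (m n : ℕ) (F : List A → ℤ) →
  ∑ (words xs (m ℕ.+ n)) F ≡ ∑[ u ← words xs m ] ∑[ w ← words xs n ] F (u ++ w)
∑-words-+ xs zero    n F = sym (ℤₚ.+-identityʳ _)
∑-words-+ xs (suc m) n F = begin
  ∑ (words xs (suc m ℕ.+ n)) F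
    ≡⟨ ∑-words-suc xs (m ℕ.+ n) F ⟩
  ∑[ x ← xs ] ∑ (words xs (m ℕ.+ n)) (λ w → F (x ∷ w))
    ≡⟨ ∑-cong xs (λ x → ∑-words-+ xs m n (λ w → F (x ∷ w))) ⟩
  ∑[ x ← xs ] ∑[ u ← words xs m ] ∑[ w ← words xs n ] F (x ∷ u ++ w)
    ≡⟨ ∑-words-suc xs m _ ⟨
  ∑[ u ← words xs (suc m) ] ∑[ w ← words xs n ] F (u ++ w) ∎
  where open ≡-Reasoning

∈-words⁺ : {xs : List A} {w : List A} → All (_∈ xs) w → w ∈ words xs (length w)
∈-words⁺ []       = here refl
∈-words⁺ {w = x ∷ w} (x∈ ∷ w∈) =
  ∈-concatMap⁺ _ (Any.map (λ { refl → ∈-map⁺ (x ∷_) (∈-words⁺ w∈) }) x∈)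

∈-words-length : {xs : List A} (n : ℕ) {w : List A} → w ∈ words xs n → length w ≡ n
∈-words-length zero    (here refl) = refl
∈-words-length {xs = xs} (suc n) w∈ with Any.satisfied (∈-concatMap⁻ (λ x → map (x ∷_) (words xs n)) {xs = xs} w∈)
... | x , w∈′ with ∈-map⁻ (x ∷_) w∈′
... | v , v∈ , refl = cong suc (∈-words-length n v∈)

words-Unique : {xs : List A} → Unique xs → ∀ n → Unique (words xs n)
words-Unique u zero = [] ∷ []
words-Unique {A = A} {xs = xs} u (suc n) = go u
  where
  go : {ys : List A} → Unique ys → Unique (concatMap (λ x → map (x ∷_) (words xs n)) ys)
  go []                       = []
  go {y ∷ ys} (y∉ ∷ v) = Uniqueₚ.++⁺ (Uniqueₚ.map⁺ Listₚ.∷-injectiveʳ (words-Unique u n)) (go v) disj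
    where
    disj : ∀ {w} → w ∈ map (y ∷_) (words xs n) × w ∈ concatMap (λ x → map (x ∷_) (words xs n)) ys → _
    disj (p , q) with ∈-map⁻ (y ∷_) p
    ... | _ , _ , refl with ∈-concat⁻′ (map (λ x → map (x ∷_) (words xs n)) ys) q
    ... | l , w∈l , l∈ with ∈-map⁻ _ l∈
    ... | z , z∈ , refl with ∈-map⁻ (z ∷_) w∈l
    ... | _ , _ , refl = All.lookup y∉ z∈ refl

map-toList-allVecs : ∀ k n → map toList (allVecs k n) ≡ words (allFin k) n
map-toList-allVecs k zero    = refl
map-toList-allVecs k (suc n) = begin
  map toList (concatMap (λ i → map (i Vec.∷_) (allVecs k n)) (allFin k))
    ≡⟨ Listₚ.map-concatMap toList _ (allFin k) ⟩
  concatMap (λ i → map toList (map (i Vec.∷_) (allVecs k n))) (allFin k)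
    ≡⟨ Listₚ.concatMap-cong prepend (allFin k) ⟩
  words (allFin k) (suc n) ∎
  where
  open ≡-Reasoning
  prepend : ∀ i → map toList (map (i Vec.∷_) (allVecs k n)) ≡ map (i ∷_) (words (allFin k) n)
  prepend i = begin
    map toList (map (i Vec.∷_) (allVecs k n)) ≡⟨ Listₚ.map-∘ (allVecs k n) ⟨
    map (λ κ → i ∷ toList κ) (allVecs k n)    ≡⟨ Listₚ.map-∘ (allVecs k n) ⟩
    map (i ∷_) (map toList (allVecs k n))     ≡⟨ cong (map (i ∷_)) (map-toList-allVecs k n) ⟩
    map (i ∷_) (words (allFin k) n)           ∎

-- Symmetric-function coefficients as weighted counts of colourings

Bool-ext : ∀ {a b} → (a ≡ true → b ≡ true) → (b ≡ true → a ≡ true) → a ≡ b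
Bool-ext {false} {false} f g = refl
Bool-ext {false} {true}  f g = g refl
Bool-ext {true}  {b}     f g = sym (f refl)

∧-true⁻ : ∀ {a b} → a ∧ b ≡ true → a ≡ true × b ≡ true
∧-true⁻ {true} {true} refl = refl , refl

isYes⁻ : {P : Set} (d : Dec P) → ⌊ d ⌋ ≡ true → P
isYes⁻ (yes p) _ = p

isYes⁺ : {P : Set} (d : Dec P) → P → ⌊ d ⌋ ≡ true
isYes⁺ d p = trans (isYes≗does d) (dec-true d p)

isYes-no : {P : Set} (d : Dec P) → ¬ P → ⌊ d ⌋ ≡ false
isYes-no d ¬p = trans (isYes≗does d) (dec-false d ¬p)

allB⁻ : ∀ {n} {P : Fin n → Bool} → allB P ≡ true → ∀ i → P i ≡ true
allB⁻ {n} {P} eq i = go (allFin n) eq (∈-allFin i)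
  where
  go : ∀ xs → Data.List.foldr (λ w b → P w ∧ b) true xs ≡ true → i ∈ xs → P i ≡ true
  go (x ∷ xs) eq (here refl) = proj₁ (∧-true⁻ eq)
  go (x ∷ xs) eq (there i∈)  = go xs (proj₂ (∧-true⁻ {P x} eq)) i∈

allB⁺ : ∀ {n} {P : Fin n → Bool} → (∀ i → P i ≡ true) → allB P ≡ true
allB⁺ {n} {P} all = go (allFin n)
  where
  go : ∀ xs → Data.List.foldr (λ w b → P w ∧ b) true xs ≡ true
  go []       = refl
  go (x ∷ xs) = cong₂ _∧_ (all x) (go xs)

map-lookup-allFin : ∀ {n} (κ : Vec A n) → map (lookup κ) (allFin n) ≡ toList κ
map-lookup-allFin κ = trans (Listₚ.map-tabulate id (lookup κ)) (go κ)
  where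
  go : ∀ {n} (κ : Vec A n) → tabulate (lookup κ) ≡ toList κ
  go Vec.[]      = refl
  go (x Vec.∷ κ) = cong (x ∷_) (go κ)

tabulate-injective : ∀ {n} {f g : Fin n → A} → tabulate f ≡ tabulate g → ∀ i → f i ≡ g i
tabulate-injective eq zero    = Listₚ.∷-injectiveˡ eq
tabulate-injective eq (suc i) = tabulate-injective (Listₚ.∷-injectiveʳ eq) i

countB≤ : ∀ {n} (P : Fin n → Bool) → countB P ≤ n
countB≤ {n} P = ℕₚ.≤-trans (go (allFin n)) (ℕₚ.≤-reflexive (Listₚ.length-tabulate id))
  where
  go : ∀ xs → sum (map (λ w → if P w then 1 else 0) xs) ≤ length xs
  go [] = z≤n
  go (x ∷ xs) with P x
  ... | true  = s≤s (go xs)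
  ... | false = ℕₚ.m≤n⇒m≤1+n (go xs)

multiplicity : ∀ {n K} → Vec (Fin K) n → Fin K → ℕ
multiplicity κ i = countB (λ u → ⌊ lookup κ u Fin.≟ i ⌋)

multiplicities : ∀ {n K} → Vec (Fin K) n → List ℕ
multiplicities κ = tabulate (multiplicity κ)

_≟ᴸ_ : (as bs : List ℕ) → Dec (as ≡ bs)
_≟ᴸ_ = Listₚ.≡-dec ℕ._≟_

-- As an equality of lists, the size condition singles out one exponent list for each colouring, so
-- sums over exponent lists collapse.
sizesB-multiplicities : ∀ {n} (a : List ℕ) (κ : Vec (Fin (length a)) n) →
  sizesB a κ ≡ ⌊ multiplicities κ ≟ᴸ a ⌋
sizesB-multiplicities a κ = Bool-ext
  (λ eq → isYes⁺ _ (trans (Listₚ.tabulate-cong (agree eq)) (Listₚ.tabulate-lookup a)))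
  (λ eq → allB⁺ {P = fits} (λ i → isYes⁺ (multiplicity κ i ℕ.≟ Data.List.lookup a i)
    (tabulate-injective (trans (isYes⁻ (multiplicities κ ≟ᴸ a) eq) (sym (Listₚ.tabulate-lookup a))) i)))
  where
  fits : Fin (length a) → Bool
  fits i = eqℕ (multiplicity κ i) (Data.List.lookup a i)
  agree : allB fits ≡ true → ∀ i → multiplicity κ i ≡ Data.List.lookup a i
  agree eq i = isYes⁻ (multiplicity κ i ℕ.≟ Data.List.lookup a i) (allB⁻ {P = fits} eq i)

X-as-sum : ∀ {n} (G : Graph n) a {K} → length a ≡ K →
  ℤ.+ X G a ≡ ∑[ κ ← allVecs K n ] (⟦ properB G κ ⟧ * ⟦ ⌊ multiplicities κ ≟ᴸ a ⌋ ⟧)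
X-as-sum {n} G a refl = trans (pos-sum _ (allVecs (length a) n)) (∑-cong (allVecs (length a) n) λ κ →
  trans (pos-indicator (properB G κ ∧ sizesB a κ))
  (trans (⟦∧⟧ (properB G κ) (sizesB a κ))
         (cong (λ b → ⟦ properB G κ ⟧ * ⟦ b ⟧) (sizesB-multiplicities a κ))))

-- The test function `f` stays arbitrary because the recursions along paths shift its argument. With
-- 0-1 weights and `f = exactly k` this is the number of proper colourings with k vertices in the
-- first group.
weightedCount : ∀ {n} (K : ℕ) → (Fin K → ℕ) → (ℕ → ℤ) → Graph n → ℤ
weightedCount {n} K w f G = ∑[ κ ← allVecs K n ] (⟦ properB G κ ⟧ * f (sum (map w (toList κ))))

weightedSum : ∀ {K} → (Fin K → ℕ) → List ℕ → ℕ
weightedSum w a = sum (Data.List.zipWith ℕ._*_ (tabulate w) a)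

zipWith-tabulate : ∀ {K} (f : A → B → C) (g : Fin K → A) (h : Fin K → B) →
  Data.List.zipWith f (tabulate g) (tabulate h) ≡ tabulate (λ i → f (g i) (h i))
zipWith-tabulate {K = zero}  f g h = refl
zipWith-tabulate {K = suc K} f g h = cong (f (g zero) (h zero) ∷_) (zipWith-tabulate f (g ∘ suc) (h ∘ suc))

pos-multiplicity : ∀ {n K} (κ : Vec (Fin K) n) i →
  ℤ.+ multiplicity κ i ≡ ∑[ c ← toList κ ] ⟦ ⌊ c Fin.≟ i ⌋ ⟧
pos-multiplicity {n} κ i = begin
  ℤ.+ multiplicity κ i
    ≡⟨ pos-sum _ (allFin n) ⟩
  ∑[ u ← allFin n ] (ℤ.+ (if ⌊ lookup κ u Fin.≟ i ⌋ then 1 else 0))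
    ≡⟨ ∑-cong (allFin n) (λ u → pos-indicator ⌊ lookup κ u Fin.≟ i ⌋) ⟩
  ∑[ u ← allFin n ] ⟦ ⌊ lookup κ u Fin.≟ i ⌋ ⟧
    ≡⟨ ∑-map (lookup κ) (allFin n) _ ⟨
  ∑[ c ← map (lookup κ) (allFin n) ] ⟦ ⌊ c Fin.≟ i ⌋ ⟧
    ≡⟨ cong (λ l → ∑[ c ← l ] ⟦ ⌊ c Fin.≟ i ⌋ ⟧) (map-lookup-allFin κ) ⟩
  ∑[ c ← toList κ ] ⟦ ⌊ c Fin.≟ i ⌋ ⟧ ∎
  where open ≡-Reasoning

weightedSum-multiplicities : ∀ {n K} (w : Fin K → ℕ) (κ : Vec (Fin K) n) →
  weightedSum w (multiplicities κ) ≡ sum (map w (toList κ))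
weightedSum-multiplicities {n} {K} w κ = ℤₚ.+-injective (begin
  ℤ.+ weightedSum w (multiplicities κ)
    ≡⟨ cong (λ l → ℤ.+ sum l) (trans (zipWith-tabulate ℕ._*_ w (multiplicity κ))
         (sym (Listₚ.map-tabulate id (λ i → w i ℕ.* multiplicity κ i)))) ⟩
  ℤ.+ sum (map (λ i → w i ℕ.* multiplicity κ i) (allFin K))
    ≡⟨ pos-sum _ (allFin K) ⟩
  ∑[ i ← allFin K ] (ℤ.+ (w i ℕ.* multiplicity κ i))
    ≡⟨ ∑-cong (allFin K) expand ⟩
  ∑[ i ← allFin K ] ∑[ c ← toList κ ] (ℤ.+ w i * ⟦ ⌊ c Fin.≟ i ⌋ ⟧)
    ≡⟨ ∑-swap (allFin K) (toList κ) _ ⟩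
  ∑[ c ← toList κ ] ∑[ i ← allFin K ] (ℤ.+ w i * ⟦ ⌊ c Fin.≟ i ⌋ ⟧)
    ≡⟨ ∑-cong (toList κ) pick ⟩
  ∑[ c ← toList κ ] (ℤ.+ w c)
    ≡⟨ pos-sum w (toList κ) ⟨
  ℤ.+ sum (map w (toList κ)) ∎)
  where
  open ≡-Reasoning
  expand : ∀ i → ℤ.+ (w i ℕ.* multiplicity κ i) ≡ ∑[ c ← toList κ ] (ℤ.+ w i * ⟦ ⌊ c Fin.≟ i ⌋ ⟧)
  expand i = begin
    ℤ.+ (w i ℕ.* multiplicity κ i)      ≡⟨ ℤₚ.pos-* (w i) (multiplicity κ i) ⟩
    ℤ.+ w i * ℤ.+ multiplicity κ i      ≡⟨ cong (_*_ (ℤ.+ w i)) (pos-multiplicity κ i) ⟩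
    ℤ.+ w i * (∑[ c ← toList κ ] ⟦ ⌊ c Fin.≟ i ⌋ ⟧) ≡⟨ ∑-*ˡ (ℤ.+ w i) (toList κ) _ ⟨
    ∑[ c ← toList κ ] (ℤ.+ w i * ⟦ ⌊ c Fin.≟ i ⌋ ⟧) ∎
  pick : ∀ c → ∑[ i ← allFin K ] (ℤ.+ w i * ⟦ ⌊ c Fin.≟ i ⌋ ⟧) ≡ ℤ.+ w c
  pick c = begin
    ∑[ i ← allFin K ] (ℤ.+ w i * ⟦ ⌊ c Fin.≟ i ⌋ ⟧)
      ≡⟨ ∑-single _ (Uniqueₚ.allFin⁺ K) (∈-allFin c) (λ {i} i≢c →
           trans (cong (λ b → ℤ.+ w i * ⟦ b ⟧) (isYes-no (c Fin.≟ i) (i≢c ∘ sym))) (ℤₚ.*-zeroʳ (ℤ.+ w i))) ⟩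
    ℤ.+ w c * ⟦ ⌊ c Fin.≟ c ⌋ ⟧
      ≡⟨ cong (λ b → ℤ.+ w c * ⟦ b ⟧) (isYes⁺ (c Fin.≟ c) refl) ⟩
    ℤ.+ w c * 1ℤ
      ≡⟨ ℤₚ.*-identityʳ (ℤ.+ w c) ⟩
    ℤ.+ w c ∎

-- After exchanging the sums, a colouring meets a single exponent list, its own multiplicities.
-- These are at most n, so the finite box of lists with entries below `b` contains it.
weightedCount-from-X : ∀ {n} (G : Graph n) K (w : Fin K → ℕ) f {b} → n < b →
  ∑[ a ← words (upTo b) K ] (f (weightedSum w a) * ℤ.+ X G a) ≡ weightedCount K w f G
weightedCount-from-X {n} G K w f {b} n<b = begin
  ∑[ a ← words (upTo b) K ] (φ a * ℤ.+ X G a)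
    ≡⟨ ∑-cong∈ (words (upTo b) K) (λ {a} a∈ → trans
         (cong (_*_ (φ a)) (X-as-sum G a (∈-words-length K a∈))) (sym (∑-*ˡ (φ a) (allVecs K n) _))) ⟩
  ∑[ a ← words (upTo b) K ] ∑[ κ ← allVecs K n ] (φ a * (⟦ properB G κ ⟧ * ⟦ ⌊ multiplicities κ ≟ᴸ a ⌋ ⟧))
    ≡⟨ ∑-swap (words (upTo b) K) (allVecs K n) _ ⟩
  ∑[ κ ← allVecs K n ] ∑[ a ← words (upTo b) K ] (φ a * (⟦ properB G κ ⟧ * ⟦ ⌊ multiplicities κ ≟ᴸ a ⌋ ⟧))
    ≡⟨ ∑-cong (allVecs K n) pick ⟩
  weightedCount K w f G ∎
  where
  open ≡-Reasoning
  φ = λ a → f (weightedSum w a)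
  pick : ∀ κ → ∑[ a ← words (upTo b) K ] (φ a * (⟦ properB G κ ⟧ * ⟦ ⌊ multiplicities κ ≟ᴸ a ⌋ ⟧))
             ≡ ⟦ properB G κ ⟧ * f (sum (map w (toList κ)))
  pick κ = begin
    ∑[ a ← words (upTo b) K ] (φ a * (⟦ properB G κ ⟧ * ⟦ ⌊ multiplicities κ ≟ᴸ a ⌋ ⟧))
      ≡⟨ ∑-single _ (words-Unique (Uniqueₚ.upTo⁺ b) K) inBox (λ {a} a≢ →
           trans (cong (λ t → φ a * (⟦ properB G κ ⟧ * ⟦ t ⟧)) (isYes-no (multiplicities κ ≟ᴸ a) (a≢ ∘ sym)))
             (zero₂ (φ a) ⟦ properB G κ ⟧)) ⟩
    φ (multiplicities κ) * (⟦ properB G κ ⟧ * ⟦ ⌊ multiplicities κ ≟ᴸ multiplicities κ ⌋ ⟧)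
      ≡⟨ cong (λ t → φ (multiplicities κ) * (⟦ properB G κ ⟧ * ⟦ t ⟧)) (isYes⁺ (multiplicities κ ≟ᴸ multiplicities κ) refl) ⟩
    φ (multiplicities κ) * (⟦ properB G κ ⟧ * 1ℤ)
      ≡⟨ one₂ (φ (multiplicities κ)) ⟦ properB G κ ⟧ ⟩
    ⟦ properB G κ ⟧ * φ (multiplicities κ)
      ≡⟨ cong (λ t → ⟦ properB G κ ⟧ * f t) (weightedSum-multiplicities w κ) ⟩
    ⟦ properB G κ ⟧ * f (sum (map w (toList κ))) ∎
    where
    zero₂ : ∀ x y → x * (y * 0ℤ) ≡ 0ℤ
    zero₂ = solve-∀
    one₂ : ∀ x y → x * (y * 1ℤ) ≡ y * x
    one₂ = solve-∀
    inBox : multiplicities κ ∈ words (upTo b) K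
    inBox = subst (λ k → multiplicities κ ∈ words (upTo b) k) (Listₚ.length-tabulate (multiplicity κ))
      (∈-words⁺ (Allₚ.tabulate⁺ (λ i → ∈-upTo⁺ (ℕₚ.≤-<-trans (countB≤ _) n<b))))

SameX⇒weightedCount : ∀ {n m} (G : Graph n) (H : Graph m) → SameX G H →
  ∀ K (w : Fin K → ℕ) f → weightedCount K w f G ≡ weightedCount K w f H
SameX⇒weightedCount {n} {m} G H same K w f = begin
  weightedCount K w f G
    -- The orders n and m are not yet known to agree, so both graphs are expanded over one box large
    -- enough for either.
    ≡⟨ weightedCount-from-X G K w f (s≤s (ℕₚ.m≤m⊔n n m)) ⟨
  ∑[ a ← words (upTo (suc (n ℕ.⊔ m))) K ] (f (weightedSum w a) * ℤ.+ X G a)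
    ≡⟨ ∑-cong (words (upTo (suc (n ℕ.⊔ m))) K) (λ a → cong (λ t → f (weightedSum w a) * ℤ.+ t) (same a)) ⟩
  ∑[ a ← words (upTo (suc (n ℕ.⊔ m))) K ] (f (weightedSum w a) * ℤ.+ X H a)
    ≡⟨ weightedCount-from-X H K w f (s≤s (ℕₚ.m≤n⊔m n m)) ⟩
  weightedCount K w f H ∎
  where open ≡-Reasoning

-- Decompositions of a graph into a rooted cycle and tentacles

pairs : List A → List (A × A)
pairs []          = []
pairs (x ∷ [])    = []
pairs (x ∷ y ∷ l) = (x , y) ∷ pairs (y ∷ l)

edges : A → List A → List (List A) → List (A × A)
edges v cs ts = pairs (v ∷ cs ++ [ v ]) ++ concatMap (λ t → pairs (v ∷ t)) ts

-- The root is the branch vertex and `arc` is the rest of the cycle, read from one neighbour of the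
-- root round to the other. The edge list carries one orientation of each edge, hence the two cases
-- of `covering`. Nonempty tentacles make the multiset of lengths recoverable from the counts of
-- lengths at least j for j ≥ 1.
record Decomposition {n} (G : Graph n) : Set where
  field
    root      : Fin n
    arc       : List (Fin n)
    tentacles : List (List (Fin n))
  vertices : List (Fin n)
  vertices = root ∷ concat (arc ∷ tentacles)
  field
    unique    : Unique vertices
    complete  : ∀ u → u ∈ vertices
    sound     : ∀ {u w} → (u , w) ∈ edges root arc tentacles → Adj G u w
    covering  : ∀ {u w} → Adj G u w →
                (u , w) ∈ edges root arc tentacles ⊎ (w , u) ∈ edges root arc tentacles
    arc-long  : 2 ≤ length arc
    nonempty  : All (λ t → 1 ≤ length t) tentacles

mapPair : (A → B) → A × A → B × B
mapPair f (u , w) = f u , f w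

map-pairs : (f : A → B) (l : List A) → map (mapPair f) (pairs l) ≡ pairs (map f l)
map-pairs f []          = refl
map-pairs f (x ∷ [])    = refl
map-pairs f (x ∷ y ∷ l) = cong ((f x , f y) ∷_) (map-pairs f (y ∷ l))

map-edges : (f : A → B) (v : A) (cs : List A) (ts : List (List A)) →
  map (mapPair f) (edges v cs ts) ≡ edges (f v) (map f cs) (map (map f) ts)
map-edges f v cs ts = begin
  map (mapPair f) (edges v cs ts)
    ≡⟨ Listₚ.map-++ (mapPair f) (pairs (v ∷ cs ++ [ v ])) _ ⟩
  map (mapPair f) (pairs (v ∷ cs ++ [ v ])) ++ map (mapPair f) (concatMap (λ t → pairs (v ∷ t)) ts)
    ≡⟨ cong₂ _++_ (trans (map-pairs f (v ∷ cs ++ [ v ])) (cong (λ l → pairs (f v ∷ l)) (Listₚ.map-++ f cs [ v ])))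
                  (go ts) ⟩
  edges (f v) (map f cs) (map (map f) ts) ∎
  where
  open ≡-Reasoning
  go : ∀ ts → map (mapPair f) (concatMap (λ t → pairs (v ∷ t)) ts) ≡ concatMap (λ t → pairs (f v ∷ t)) (map (map f) ts)
  go []       = refl
  go (t ∷ ts) = trans (Listₚ.map-++ (mapPair f) (pairs (v ∷ t)) _) (cong₂ _++_ (map-pairs f (v ∷ t)) (go ts))

map-agree : {f g : A → B} {L : List A} → map f L ≡ map g L → ∀ {u} → u ∈ L → f u ≡ g u
map-agree eq (here refl) = Listₚ.∷-injectiveˡ eq
map-agree eq (there u∈)  = map-agree (Listₚ.∷-injectiveʳ eq) u∈

-- The last argument is a default value off `L`. The lists used later exhaust the vertices, so the
-- default never matters there.
assignment : ∀ {n} (L : List (Fin n)) → Unique L → (w : List C) → length w ≡ length L → C →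
  ∃[ κ ] map κ L ≡ w
assignment []      _        []      _  c = (λ _ → c) , refl
assignment {n = n} (u ∷ L) (u∉ ∷ un) (d ∷ w) eq c with assignment L un w (ℕₚ.suc-injective eq) c
... | κ , refl = κ′ , cong₂ _∷_ κ′-here (Listₚ.map-cong-local (All.map κ′-there u∉))
  where
  κ′ : Fin n → _
  κ′ x = if ⌊ u Fin.≟ x ⌋ then d else κ x
  κ′-here : κ′ u ≡ d
  κ′-here rewrite isYes⁺ (u Fin.≟ u) refl = refl
  κ′-there : ∀ {x} → u ≢ x → κ′ x ≡ κ x
  κ′-there {x} u≢x rewrite isYes-no (u Fin.≟ x) u≢x = refl

∈-allVecs : ∀ {k n} (κ : Vec (Fin k) n) → κ ∈ allVecs k n
∈-allVecs Vec.[]      = here refl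
∈-allVecs {k} {suc n} (i Vec.∷ κ) =
  ∈-concatMap⁺ (λ i → map (i Vec.∷_) (allVecs k n)) (Any.map (λ { refl → ∈-map⁺ (i Vec.∷_) (∈-allVecs κ) }) (∈-allFin i))

allVecs-Unique : ∀ k n → Unique (allVecs k n)
allVecs-Unique k n = Uniqueₚ.map⁻ (subst Unique (sym (map-toList-allVecs k n)) (words-Unique (Uniqueₚ.allFin⁺ k) n))

lookup-injective : ∀ {n} {κ κ′ : Vec A n} → (∀ u → lookup κ u ≡ lookup κ′ u) → κ ≡ κ′
lookup-injective {κ = κ} {κ′} eq =
  trans (sym (Vecₚ.tabulate∘lookup κ)) (trans (Vecₚ.tabulate-cong eq) (Vecₚ.tabulate∘lookup κ′))

-- Reading the colours along a list that meets every vertex once is a bijection from colourings to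
-- words. The list is given as nonempty so that the first letter of a word can serve as the default
-- for `assignment`.
∑-reindex : ∀ {n K} (v : Fin n) (L : List (Fin n)) → Unique (v ∷ L) → (∀ u → u ∈ v ∷ L) → (Φ : List (Fin K) → ℤ) →
  ∑[ κ ← allVecs K n ] Φ (map (lookup κ) (v ∷ L)) ≡ ∑ (words (allFin K) (length (v ∷ L))) Φ
∑-reindex {n} {K} v L un complete Φ = trans
  (sym (∑-map (λ κ → map (lookup κ) (v ∷ L)) (allVecs K n) Φ))
  (∑-↭ Φ (∼bag⇒↭ (unique∧set⇒bag
    (Uniqueₚ.map⁺ (λ eq → lookup-injective (λ u → map-agree eq (complete u))) (allVecs-Unique K n))
    (words-Unique (Uniqueₚ.allFin⁺ K) (length (v ∷ L)))
    (mk⇔ to from))))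
  where
  to : ∀ {w} → w ∈ map (λ κ → map (lookup κ) (v ∷ L)) (allVecs K n) → w ∈ words (allFin K) (length (v ∷ L))
  to w∈ with ∈-map⁻ (λ κ → map (lookup κ) (v ∷ L)) w∈
  ... | κ , _ , refl = subst (λ k → map (lookup κ) (v ∷ L) ∈ words (allFin K) k) (Listₚ.length-map (lookup κ) (v ∷ L))
    (∈-words⁺ (All.universal ∈-allFin _))
  from : ∀ {w} → w ∈ words (allFin K) (length (v ∷ L)) → w ∈ map (λ κ → map (lookup κ) (v ∷ L)) (allVecs K n)
  from {[]} w∈ with () ← ∈-words-length {xs = allFin K} (length (v ∷ L)) w∈
  from {c ∷ w} w∈ with assignment (v ∷ L) un (c ∷ w) (∈-words-length {xs = allFin K} (length (v ∷ L)) w∈) c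
  ... | κ , eq = subst (_∈ map (λ κ → map (lookup κ) (v ∷ L)) (allVecs K n)) (trans (Listₚ.map-cong (Vecₚ.lookup∘tabulate κ) (v ∷ L)) eq)
    (∈-map⁺ (λ κ → map (lookup κ) (v ∷ L)) (∈-allVecs (Vec.tabulate κ)))

-- Words cut into blocks, and properness read off the edge list

chop : List ℕ → List A → List (List A)
chop []       w = []
chop (n ∷ ns) w = Data.List.take n w ∷ chop ns (Data.List.drop n w)

chop-++ : (u w : List A) (ns : List ℕ) → chop (length u ∷ ns) (u ++ w) ≡ u ∷ chop ns w
chop-++ u w ns = cong₂ _∷_ (take-++ u) (cong (chop ns) (drop-++ u))
  where
  take-++ : ∀ u → Data.List.take (length u) (u ++ w) ≡ u
  take-++ []      = refl
  take-++ (x ∷ u) = cong (x ∷_) (take-++ u)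
  drop-++ : ∀ u → Data.List.drop (length u) (u ++ w) ≡ w
  drop-++ []      = refl
  drop-++ (x ∷ u) = drop-++ u

chop-concat : (ts : List (List A)) → chop (map length ts) (concat ts) ≡ ts
chop-concat []       = refl
chop-concat (t ∷ ts) = trans (chop-++ t (concat ts) (map length ts)) (cong (t ∷_) (chop-concat ts))

wordLists : List A → List ℕ → List (List (List A))
wordLists xs []       = [ [] ]
wordLists xs (n ∷ ns) = concatMap (λ t → map (t ∷_) (wordLists xs ns)) (words xs n)

∑-wordLists-∷ : (xs : List A) (n : ℕ) (ns : List ℕ) (F : List (List A) → ℤ) →
  ∑ (wordLists xs (n ∷ ns)) F ≡ ∑[ t ← words xs n ] ∑[ ts ← wordLists xs ns ] F (t ∷ ts)
∑-wordLists-∷ xs n ns F = trans (∑-concatMap _ (words xs n) F) (∑-cong (words xs n) (λ t → ∑-map (t ∷_) (wordLists xs ns) F))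

∑-chop : (xs : List A) (ns : List ℕ) (F : List (List A) → ℤ) →
  ∑[ w ← words xs (sum ns) ] F (chop ns w) ≡ ∑ (wordLists xs ns) F
∑-chop xs []       F = refl
∑-chop xs (n ∷ ns) F = begin
  ∑[ w ← words xs (n ℕ.+ sum ns) ] F (chop (n ∷ ns) w)
    ≡⟨ ∑-words-+ xs n (sum ns) _ ⟩
  ∑[ t ← words xs n ] ∑[ w ← words xs (sum ns) ] F (chop (n ∷ ns) (t ++ w))
    ≡⟨ ∑-cong∈ (words xs n) (λ {t} t∈ → ∑-cong (words xs (sum ns)) (λ w → cong F (split t w (∈-words-length n t∈)))) ⟩
  ∑[ t ← words xs n ] ∑[ w ← words xs (sum ns) ] F (t ∷ chop ns w)
    ≡⟨ ∑-cong (words xs n) (λ t → ∑-chop xs ns (λ ts → F (t ∷ ts))) ⟩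
  ∑[ t ← words xs n ] ∑[ ts ← wordLists xs ns ] F (t ∷ ts)
    ≡⟨ ∑-wordLists-∷ xs n ns F ⟨
  ∑ (wordLists xs (n ∷ ns)) F ∎
  where
  open ≡-Reasoning
  split : ∀ t w → length t ≡ n → chop (n ∷ ns) (t ++ w) ≡ t ∷ chop ns w
  split t w refl = chop-++ t w ns

length-concat : (ts : List (List A)) → length (concat ts) ≡ sum (map length ts)
length-concat []       = refl
length-concat (t ∷ ts) = trans (Listₚ.length-++ t) (cong (length t ℕ.+_) (length-concat ts))

differ : ∀ {K} → Fin K × Fin K → Bool
differ (c , d) = not ⌊ c Fin.≟ d ⌋

allDiffer : ∀ {K} → List (Fin K × Fin K) → Bool
allDiffer []      = true
allDiffer (e ∷ l) = differ e ∧ allDiffer l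

allDiffer-++ : ∀ {K} (l l′ : List (Fin K × Fin K)) → ⟦ allDiffer (l ++ l′) ⟧ ≡ ⟦ allDiffer l ⟧ * ⟦ allDiffer l′ ⟧
allDiffer-++ []      l′ = sym (ℤₚ.*-identityˡ _)
allDiffer-++ (e ∷ l) l′ = begin
  ⟦ differ e ∧ allDiffer (l ++ l′) ⟧              ≡⟨ ⟦∧⟧ (differ e) _ ⟩
  ⟦ differ e ⟧ * ⟦ allDiffer (l ++ l′) ⟧          ≡⟨ cong (_*_ ⟦ differ e ⟧) (allDiffer-++ l l′) ⟩
  ⟦ differ e ⟧ * (⟦ allDiffer l ⟧ * ⟦ allDiffer l′ ⟧) ≡⟨ ℤₚ.*-assoc ⟦ differ e ⟧ ⟦ allDiffer l ⟧ ⟦ allDiffer l′ ⟧ ⟨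
  ⟦ differ e ⟧ * ⟦ allDiffer l ⟧ * ⟦ allDiffer l′ ⟧ ≡⟨ cong (_* ⟦ allDiffer l′ ⟧) (⟦∧⟧ (differ e) (allDiffer l)) ⟨
  ⟦ differ e ∧ allDiffer l ⟧ * ⟦ allDiffer l′ ⟧   ∎
  where open ≡-Reasoning

allDiffer⁻ : ∀ {K} {l : List (Fin K × Fin K)} → allDiffer l ≡ true → ∀ {e} → e ∈ l → differ e ≡ true
allDiffer⁻ eq (here refl) = proj₁ (∧-true⁻ eq)
allDiffer⁻ {l = e ∷ l} eq (there e∈)  = allDiffer⁻ (proj₂ (∧-true⁻ {differ e} eq)) e∈

allDiffer⁺ : ∀ {K} (l : List (Fin K × Fin K)) → (∀ {e} → e ∈ l → differ e ≡ true) → allDiffer l ≡ true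
allDiffer⁺ []      h = refl
allDiffer⁺ (e ∷ l) h = cong₂ _∧_ (h (here refl)) (allDiffer⁺ l (h ∘ there))

differ-sym : ∀ {K} {c d : Fin K} → differ (c , d) ≡ true → differ (d , c) ≡ true
differ-sym {c = c} {d} eq with c Fin.≟ d | d Fin.≟ c
... | no  _ | no _     = refl
... | no ¬p | yes refl = contradiction refl ¬p

module _ {n} {G : Graph n} (D : Decomposition G) where
  open Decomposition D

  properB-edges : ∀ {K} (κ : Vec (Fin K) n) →
    properB G κ ≡ allDiffer (edges (lookup κ root) (map (lookup κ) arc) (map (map (lookup κ)) tentacles))
  properB-edges κ = trans (Bool-ext to from) (cong allDiffer (map-edges (lookup κ) root arc tentacles))
    where
    E = edges root arc tentacles
    fine : Fin n → Fin n → Bool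
    fine u v = if adj G u v then not ⌊ lookup κ u Fin.≟ lookup κ v ⌋ else true
    to : properB G κ ≡ true → allDiffer (map (mapPair (lookup κ)) E) ≡ true
    to eq = allDiffer⁺ _ λ e∈ → go (∈-map⁻ (mapPair (lookup κ)) e∈)
      where
      go : ∀ {e} → (∃ λ p → p ∈ E × e ≡ mapPair (lookup κ) p) → differ e ≡ true
      go ((u , v) , p∈ , refl) = subst (λ b → (if b then _ else true) ≡ true) (sound p∈)
        (allB⁻ {P = fine u} (allB⁻ {P = λ u → allB (fine u)} eq u) v)
    from : allDiffer (map (mapPair (lookup κ)) E) ≡ true → properB G κ ≡ true
    from eq = allB⁺ {P = λ u → allB (fine u)} (λ u → allB⁺ {P = fine u} (λ v → go u v))
      where
      go : ∀ u v → fine u v ≡ true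
      go u v with adj G u v in uv
      ... | false = refl
      ... | true with covering uv
      ...   | inj₁ e∈ = allDiffer⁻ eq (∈-map⁺ (mapPair (lookup κ)) e∈)
      ...   | inj₂ e∈ = differ-sym (allDiffer⁻ eq (∈-map⁺ (mapPair (lookup κ)) e∈))

  weightedCount-decomposed : ∀ K (w : Fin K → ℕ) f → weightedCount K w f G ≡
    ∑[ c ← allFin K ] ∑[ cs ← words (allFin K) (length arc) ] ∑[ ts ← wordLists (allFin K) (map length tentacles) ]
      (⟦ allDiffer (edges c cs ts) ⟧ * f (sum (map w (c ∷ concat (cs ∷ ts)))))
  weightedCount-decomposed K w f = begin
    weightedCount K w f G
      ≡⟨ ∑-cong (allVecs K n) perColouring ⟩
    ∑[ κ ← allVecs K n ] Φ (map (lookup κ) vertices)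
      ≡⟨ ∑-reindex root (concat (arc ∷ tentacles)) unique complete Φ ⟩
    ∑ (words (allFin K) (length vertices)) Φ
      ≡⟨ ∑-words-suc (allFin K) (length (concat (arc ∷ tentacles))) Φ ⟩
    ∑[ c ← allFin K ] ∑[ l ← words (allFin K) (length (concat (arc ∷ tentacles))) ] Φ (c ∷ l)
      ≡⟨ ∑-cong (allFin K) (λ c → cong (λ k → ∑[ l ← words (allFin K) k ] Φ (c ∷ l)) (length-concat (arc ∷ tentacles))) ⟩
    ∑[ c ← allFin K ] ∑[ l ← words (allFin K) (sum shape) ] F c (chop shape l)
      ≡⟨ ∑-cong (allFin K) (λ c → ∑-chop (allFin K) shape (F c)) ⟩
    ∑[ c ← allFin K ] ∑ (wordLists (allFin K) shape) (F c)
      ≡⟨ ∑-cong (allFin K) (λ c → ∑-wordLists-∷ (allFin K) (length arc) (map length tentacles) (F c)) ⟩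
    _ ∎
    where
    open ≡-Reasoning
    shape = map length (arc ∷ tentacles)
    -- The clauses for the empty list here and in `Φ` are placeholders: `shape` always has a first
    -- entry and `vertices` starts with the root.
    F : Fin K → List (List (Fin K)) → ℤ
    F c []        = 0ℤ
    F c (cs ∷ ts) = ⟦ allDiffer (edges c cs ts) ⟧ * f (sum (map w (c ∷ concat (cs ∷ ts))))
    Φ : List (Fin K) → ℤ
    Φ []      = 0ℤ
    Φ (c ∷ l) = F c (chop shape l)
    perColouring : ∀ κ → ⟦ properB G κ ⟧ * f (sum (map w (toList κ))) ≡ Φ (map (lookup κ) vertices)
    perColouring κ = begin
      ⟦ properB G κ ⟧ * f (sum (map w (toList κ)))
        ≡⟨ cong₂ (λ b s → ⟦ b ⟧ * f s) (properB-edges κ) sameWeight ⟩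
      ⟦ allDiffer (edges (lookup κ root) (map (lookup κ) arc) (map (map (lookup κ)) tentacles)) ⟧
        * f (sum (map w (map (lookup κ) vertices)))
        ≡⟨ cong (λ l → ⟦ allDiffer (edges (lookup κ root) (map (lookup κ) arc) (map (map (lookup κ)) tentacles)) ⟧ * f (sum (map w (lookup κ root ∷ l))))
             (sym (Listₚ.concat-map (arc ∷ tentacles))) ⟩
      F (lookup κ root) (map (map (lookup κ)) (arc ∷ tentacles))
        ≡⟨ cong (F (lookup κ root)) (chop-concat (map (map (lookup κ)) (arc ∷ tentacles))) ⟨
      F (lookup κ root) (chop (map length (map (map (lookup κ)) (arc ∷ tentacles))) (concat (map (map (lookup κ)) (arc ∷ tentacles))))
        ≡⟨ cong₂ (λ s l → F (lookup κ root) (chop s l)) sameShape (Listₚ.concat-map (arc ∷ tentacles)) ⟩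
      Φ (map (lookup κ) vertices) ∎
      where
      sameShape : map length (map (map (lookup κ)) (arc ∷ tentacles)) ≡ shape
      sameShape = trans (sym (Listₚ.map-∘ (arc ∷ tentacles))) (Listₚ.map-cong (Listₚ.length-map (lookup κ)) (arc ∷ tentacles))
      vertices↭ : allFin n ↭ vertices
      vertices↭ = ∼bag⇒↭ (unique∧set⇒bag (Uniqueₚ.allFin⁺ n) unique (mk⇔ (λ _ → complete _) (λ _ → ∈-allFin _)))
      sameWeight : sum (map w (toList κ)) ≡ sum (map w (map (lookup κ) vertices))
      sameWeight = trans (cong (λ l → sum (map w l)) (sym (map-lookup-allFin κ)))
        (sum-↭ (↭ₚ.map⁺ w (↭ₚ.map⁺ (lookup κ) vertices↭)))

-- Two groups of q colours: transfer recursions for paths, tentacles and cycles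

-- Two successors at a time, so that `group` can deal the colours alternately and each step of q
-- adds one colour to either group.
double : ℕ → ℕ
double zero    = zero
double (suc q) = suc (suc (double q))

group : ∀ {q} → Fin (double q) → Bool
group {suc q} zero          = true
group {suc q} (suc zero)    = false
group {suc q} (suc (suc c)) = group {q} c

wt : Bool → ℕ
wt b = if b then 1 else 0

∑-group : ∀ q (F : Bool → ℤ) → ∑[ c ← allFin (double q) ] F (group c) ≡ ℤ.+ q * (F true + F false)
∑-group zero    F = refl
∑-group (suc q) F = begin
  F true + (F false + ∑[ c ← tabulate (λ i → suc (suc i)) ] F (group {suc q} c))
    ≡⟨ cong (λ l → F true + (F false + ∑[ c ← l ] F (group {suc q} c))) (Listₚ.map-tabulate {n = double q} id (λ i → suc (suc i))) ⟨
  F true + (F false + ∑[ c ← map (λ i → suc (suc i)) (allFin (double q)) ] F (group {suc q} c))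
    ≡⟨ cong (λ s → F true + (F false + s)) (trans (∑-map (λ i → suc (suc i)) (allFin (double q)) _) (∑-group q F)) ⟩
  F true + (F false + ℤ.+ q * (F true + F false))
    ≡⟨ regroup (F true) (F false) (ℤ.+ q) ⟩
  (1ℤ + ℤ.+ q) * (F true + F false) ∎
  where
  open ≡-Reasoning
  regroup : ∀ a b k → a + (b + k * (a + b)) ≡ (1ℤ + k) * (a + b)
  regroup = solve-∀

∑-differ : ∀ {K} (c : Fin K) (H : Fin K → ℤ) →
  ∑[ d ← allFin K ] (⟦ differ (c , d) ⟧ * H d) ≡ ∑ (allFin K) H - H c
∑-differ {K} c H = begin
  ∑[ d ← allFin K ] (⟦ differ (c , d) ⟧ * H d)
    ≡⟨ ∑-cong (allFin K) (λ d → complement ⌊ c Fin.≟ d ⌋ (H d)) ⟩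
  ∑[ d ← allFin K ] (H d + -1ℤ * (⟦ ⌊ c Fin.≟ d ⌋ ⟧ * H d))
    ≡⟨ trans (∑-+ (allFin K) H _) (cong (_+_ (∑ (allFin K) H)) (∑-*ˡ -1ℤ (allFin K) _)) ⟩
  ∑ (allFin K) H + -1ℤ * ∑[ d ← allFin K ] (⟦ ⌊ c Fin.≟ d ⌋ ⟧ * H d)
    ≡⟨ cong (λ s → ∑ (allFin K) H + -1ℤ * s) (∑-single _ (Uniqueₚ.allFin⁺ K) (∈-allFin c)
         (λ {d} d≢c → cong (λ b → ⟦ b ⟧ * H d) (isYes-no (c Fin.≟ d) (d≢c ∘ sym)))) ⟩
  ∑ (allFin K) H + -1ℤ * (⟦ ⌊ c Fin.≟ c ⌋ ⟧ * H c)
    ≡⟨ cong (λ b → ∑ (allFin K) H + -1ℤ * (⟦ b ⟧ * H c)) (isYes⁺ (c Fin.≟ c) refl) ⟩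
  ∑ (allFin K) H + -1ℤ * (1ℤ * H c)
    ≡⟨ tidy (∑ (allFin K) H) (H c) ⟩
  ∑ (allFin K) H - H c ∎
  where
  open ≡-Reasoning
  complement : ∀ b x → ⟦ not b ⟧ * x ≡ x + -1ℤ * (⟦ b ⟧ * x)
  complement true  = solve-∀
  complement false = solve-∀
  tidy : ∀ a b → a + -1ℤ * (1ℤ * b) ≡ a - b
  tidy = solve-∀

-- Of the colours different from `c`, q - 1 lie in its group and q in the other. All later powers of
-- q along the edges come from this asymmetry.
∑-differ-group : ∀ q (c : Fin (double q)) (F : Bool → ℤ) →
  ∑[ d ← allFin (double q) ] (⟦ differ (c , d) ⟧ * F (group d)) ≡ (ℤ.+ q - 1ℤ) * F (group c) + ℤ.+ q * F (not (group c))
∑-differ-group q c F = trans (∑-differ c (F ∘ group)) (trans (cong (_- F (group c)) (∑-group q F)) (go (group c)))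
  where
  same : ∀ k a b → k * (a + b) - a ≡ (k - 1ℤ) * a + k * b
  same = solve-∀
  other : ∀ k a b → k * (a + b) - b ≡ (k - 1ℤ) * b + k * a
  other = solve-∀
  go : ∀ b → ℤ.+ q * (F true + F false) - F b ≡ (ℤ.+ q - 1ℤ) * F b + ℤ.+ q * F (not b)
  go true  = same (ℤ.+ q) (F true) (F false)
  go false = other (ℤ.+ q) (F true) (F false)

-- `b` is the group of the vertex before the path, and `f` is a continuation: it receives the number
-- of first-group vertices on the path, not counting that starting vertex. `tentacleSum` nests such
-- continuations, since tentacles interact only through the group of the root.
pathSum : ℕ → ℕ → Bool → (ℕ → ℤ) → ℤ
pathSum q zero    b f = f 0
pathSum q (suc ℓ) b f =
  (ℤ.+ q - 1ℤ) * pathSum q ℓ b (λ m → f (wt b ℕ.+ m)) + ℤ.+ q * pathSum q ℓ (not b) (λ m → f (wt (not b) ℕ.+ m))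

tentacleSum : ℕ → List ℕ → Bool → (ℕ → ℤ) → ℤ
tentacleSum q []       b f = f 0
tentacleSum q (ℓ ∷ ℓs) b f = pathSum q ℓ b (λ m → tentacleSum q ℓs b (λ m′ → f (m ℕ.+ m′)))

-- A path of suc ℓ vertices attached to the root closes up unless its last colour is the root's,
-- and in that case its first ℓ vertices close up.
closedSum : ℕ → ℕ → Bool → (ℕ → ℤ) → ℤ
closedSum q zero    b h = 0ℤ
closedSum q (suc ℓ) b h = pathSum q (suc ℓ) b h - closedSum q ℓ b (λ m → h (wt b ℕ.+ m))

rootedSum : ℕ → ℕ → List ℕ → (ℕ → ℤ) → Bool → ℤ
rootedSum q ℓ ns f b = closedSum q ℓ b (λ m → tentacleSum q ns b (λ m′ → f (wt b ℕ.+ (m ℕ.+ m′))))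

module _ (q : ℕ) where
  private
    K = double q
    colours = allFin K
    w : Fin K → ℕ
    w c = wt (group c)
    W : List (Fin K) → ℕ
    W l = sum (map w l)

  W-++ : ∀ l l′ → W (l ++ l′) ≡ W l ℕ.+ W l′
  W-++ l l′ = trans (cong sum (Listₚ.map-++ w l l′)) (sum-++ (map w l) (map w l′))

  ∑-first : ∀ ℓ c (rest : Fin K → List (Fin K) → List (Fin K × Fin K)) (f : ℕ → ℤ) →
    ∑[ d ← colours ] ∑[ t ← words colours ℓ ] (⟦ allDiffer ((c , d) ∷ rest d t) ⟧ * f (W (d ∷ t)))
    ≡ ∑[ d ← colours ] (⟦ differ (c , d) ⟧ * ∑[ t ← words colours ℓ ] (⟦ allDiffer (rest d t) ⟧ * f (w d ℕ.+ W t)))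
  ∑-first ℓ c rest f = ∑-cong colours λ d → trans
    (∑-cong (words colours ℓ) (λ t → trans (cong (_* f (W (d ∷ t))) (⟦∧⟧ (differ (c , d)) _)) (ℤₚ.*-assoc ⟦ differ (c , d) ⟧ _ _)))
    (∑-*ˡ ⟦ differ (c , d) ⟧ (words colours ℓ) _)

  ∑-path : ∀ ℓ c f → ∑[ t ← words colours ℓ ] (⟦ allDiffer (pairs (c ∷ t)) ⟧ * f (W t)) ≡ pathSum q ℓ (group c) f
  ∑-path zero    c f = trans (ℤₚ.+-identityʳ _) (ℤₚ.*-identityˡ (f 0))
  ∑-path (suc ℓ) c f = begin
    ∑[ t ← words colours (suc ℓ) ] (⟦ allDiffer (pairs (c ∷ t)) ⟧ * f (W t))
      ≡⟨ ∑-words-suc colours ℓ _ ⟩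
    ∑[ d ← colours ] ∑[ t ← words colours ℓ ] (⟦ allDiffer ((c , d) ∷ pairs (d ∷ t)) ⟧ * f (W (d ∷ t)))
      ≡⟨ ∑-first ℓ c (λ d t → pairs (d ∷ t)) f ⟩
    ∑[ d ← colours ] (⟦ differ (c , d) ⟧ * ∑[ t ← words colours ℓ ] (⟦ allDiffer (pairs (d ∷ t)) ⟧ * f (w d ℕ.+ W t)))
      ≡⟨ ∑-cong colours (λ d → cong (_*_ ⟦ differ (c , d) ⟧) (∑-path ℓ d (λ m → f (w d ℕ.+ m)))) ⟩
    ∑[ d ← colours ] (⟦ differ (c , d) ⟧ * pathSum q ℓ (group d) (λ m → f (wt (group d) ℕ.+ m)))
      ≡⟨ ∑-differ-group q c (λ b → pathSum q ℓ b (λ m → f (wt b ℕ.+ m))) ⟩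
    pathSum q (suc ℓ) (group c) f ∎
    where open ≡-Reasoning

  ∑-tentacles : ∀ ns c f →
    ∑[ ts ← wordLists colours ns ] (⟦ allDiffer (concatMap (λ t → pairs (c ∷ t)) ts) ⟧ * f (W (concat ts)))
    ≡ tentacleSum q ns (group c) f
  ∑-tentacles []       c f = trans (ℤₚ.+-identityʳ _) (ℤₚ.*-identityˡ (f 0))
  ∑-tentacles (n ∷ ns) c f = begin
    ∑[ ts ← wordLists colours (n ∷ ns) ] (⟦ allDiffer (tied ts) ⟧ * f (W (concat ts)))
      ≡⟨ ∑-wordLists-∷ colours n ns _ ⟩
    ∑[ t ← words colours n ] ∑[ ts ← wordLists colours ns ] (⟦ allDiffer (tied (t ∷ ts)) ⟧ * f (W (t ++ concat ts)))
      ≡⟨ ∑-cong (words colours n) (λ t → trans (∑-cong (wordLists colours ns) (factor t)) (∑-*ˡ ⟦ allDiffer (pairs (c ∷ t)) ⟧ (wordLists colours ns) _)) ⟩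
    ∑[ t ← words colours n ] (⟦ allDiffer (pairs (c ∷ t)) ⟧ *
      ∑[ ts ← wordLists colours ns ] (⟦ allDiffer (tied ts) ⟧ * f (W t ℕ.+ W (concat ts))))
      ≡⟨ ∑-cong (words colours n) (λ t → cong (_*_ ⟦ allDiffer (pairs (c ∷ t)) ⟧) (∑-tentacles ns c (λ m′ → f (W t ℕ.+ m′)))) ⟩
    ∑[ t ← words colours n ] (⟦ allDiffer (pairs (c ∷ t)) ⟧ * tentacleSum q ns (group c) (λ m′ → f (W t ℕ.+ m′)))
      ≡⟨ ∑-path n c (λ m → tentacleSum q ns (group c) (λ m′ → f (m ℕ.+ m′))) ⟩
    tentacleSum q (n ∷ ns) (group c) f ∎
    where
    open ≡-Reasoning
    tied = concatMap (λ t → pairs (c ∷ t))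
    factor : ∀ t ts → ⟦ allDiffer (tied (t ∷ ts)) ⟧ * f (W (t ++ concat ts))
      ≡ ⟦ allDiffer (pairs (c ∷ t)) ⟧ * (⟦ allDiffer (tied ts) ⟧ * f (W t ℕ.+ W (concat ts)))
    factor t ts = trans
      (cong₂ (λ x s → x * f s) (allDiffer-++ (pairs (c ∷ t)) (tied ts)) (W-++ t (concat ts)))
      (ℤₚ.*-assoc ⟦ allDiffer (pairs (c ∷ t)) ⟧ _ _)

  private
    openCycle : ℕ → Fin K → Fin K → (ℕ → ℤ) → ℤ
    openCycle ℓ e c h = ∑[ cs ← words colours ℓ ] (⟦ allDiffer (pairs (c ∷ cs ++ [ e ])) ⟧ * h (W cs))

    openCycle-zero : ∀ e c h → openCycle 0 e c h ≡ ⟦ differ (c , e) ⟧ * h 0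
    openCycle-zero e c h = trans (ℤₚ.+-identityʳ _) (cong (_* h 0) (trans (⟦∧⟧ (differ (c , e)) true) (ℤₚ.*-identityʳ ⟦ differ (c , e) ⟧)))

    openCycle-suc : ∀ ℓ e c h → openCycle (suc ℓ) e c h ≡
      ∑[ d ← colours ] (⟦ differ (c , d) ⟧ * openCycle ℓ e d (λ m → h (w d ℕ.+ m)))
    openCycle-suc ℓ e c h = trans (∑-words-suc colours ℓ _) (∑-first ℓ c (λ d t → pairs (d ∷ t ++ [ e ])) h)

    differ-comm : ∀ (c d : Fin K) → differ (c , d) ≡ differ (d , c)
    differ-comm c d = Bool-ext differ-sym differ-sym

    -- A last colour is either different from `e` or equal to it, which gives the two terms. The end
    -- colour `e` is kept apart from the start colour `c` because the induction moves `c` along the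
    -- path while `e` stays; the cycle is the case `e = c`.
    openCycle-rec : ∀ ℓ e c h →
      openCycle (suc ℓ) e c h + openCycle ℓ e c (λ m → h (w e ℕ.+ m)) ≡ pathSum q (suc ℓ) (group c) h
    openCycle-rec zero e c h = begin
      openCycle 1 e c h + openCycle 0 e c (λ m → h (w e ℕ.+ m))
        ≡⟨ cong₂ _+_ (openCycle-suc 0 e c h) (openCycle-zero e c (λ m → h (w e ℕ.+ m))) ⟩
      ∑[ d ← colours ] (⟦ differ (c , d) ⟧ * openCycle 0 e d (λ m → h (w d ℕ.+ m))) + H e
        -- Read as a sum of `H` over the colours different from `e`, the first term misses exactly
        -- `H e`, which the second term supplies.
        ≡⟨ cong (_+ H e) (∑-cong colours reorder) ⟩
      ∑[ d ← colours ] (⟦ differ (e , d) ⟧ * H d) + H e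
        ≡⟨ cong (_+ H e) (∑-differ e H) ⟩
      ∑ colours H - H e + H e
        ≡⟨ cancel (∑ colours H) (H e) ⟩
      ∑ colours H
        ≡⟨ ∑-differ-group q c (λ b → h (wt b ℕ.+ 0)) ⟩
      pathSum q 1 (group c) h ∎
      where
      open ≡-Reasoning
      H : Fin K → ℤ
      H d = ⟦ differ (c , d) ⟧ * h (w d ℕ.+ 0)
      commute : ∀ a b x → a * (b * x) ≡ b * (a * x)
      commute = solve-∀
      cancel : ∀ a b → a - b + b ≡ a
      cancel = solve-∀
      reorder : ∀ d → ⟦ differ (c , d) ⟧ * openCycle 0 e d (λ m → h (w d ℕ.+ m)) ≡ ⟦ differ (e , d) ⟧ * H d
      reorder d = trans (cong (_*_ ⟦ differ (c , d) ⟧) (openCycle-zero e d (λ m → h (w d ℕ.+ m))))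
        (trans (commute ⟦ differ (c , d) ⟧ ⟦ differ (d , e) ⟧ (h (w d ℕ.+ 0)))
               (cong (λ b → ⟦ b ⟧ * H d) (differ-comm d e)))
    openCycle-rec (suc ℓ) e c h = begin
      openCycle (suc (suc ℓ)) e c h + openCycle (suc ℓ) e c (λ m → h (w e ℕ.+ m))
        ≡⟨ cong₂ _+_ (openCycle-suc (suc ℓ) e c h) (openCycle-suc ℓ e c (λ m → h (w e ℕ.+ m))) ⟩
      ∑[ d ← colours ] (δ d * openCycle (suc ℓ) e d (λ m → h (w d ℕ.+ m)))
        + ∑[ d ← colours ] (δ d * openCycle ℓ e d (λ m → h (w e ℕ.+ (w d ℕ.+ m))))
        ≡⟨ ∑-+ colours _ _ ⟨
      ∑[ d ← colours ] (δ d * openCycle (suc ℓ) e d (λ m → h (w d ℕ.+ m)) + δ d * openCycle ℓ e d (λ m → h (w e ℕ.+ (w d ℕ.+ m))))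
        ≡⟨ ∑-cong colours merge ⟩
      ∑[ d ← colours ] (δ d * pathSum q (suc ℓ) (group d) (λ m → h (wt (group d) ℕ.+ m)))
        ≡⟨ ∑-differ-group q c (λ b → pathSum q (suc ℓ) b (λ m → h (wt b ℕ.+ m))) ⟩
      pathSum q (suc (suc ℓ)) (group c) h ∎
      where
      open ≡-Reasoning
      δ : Fin K → ℤ
      δ d = ⟦ differ (c , d) ⟧
      exchange : ∀ x y z → x ℕ.+ (y ℕ.+ z) ≡ y ℕ.+ (x ℕ.+ z)
      exchange x y z = trans (sym (ℕₚ.+-assoc x y z)) (trans (cong (ℕ._+ z) (ℕₚ.+-comm x y)) (ℕₚ.+-assoc y x z))
      merge : ∀ d → δ d * openCycle (suc ℓ) e d (λ m → h (w d ℕ.+ m)) + δ d * openCycle ℓ e d (λ m → h (w e ℕ.+ (w d ℕ.+ m)))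
        ≡ δ d * pathSum q (suc ℓ) (group d) (λ m → h (w d ℕ.+ m))
      merge d = trans (sym (ℤₚ.*-distribˡ-+ (δ d) _ _)) (cong (_*_ (δ d)) (trans
        (cong (_+_ (openCycle (suc ℓ) e d (λ m → h (w d ℕ.+ m)))) (∑-cong (words colours ℓ)
          (λ cs → cong (λ s → ⟦ allDiffer (pairs (d ∷ cs ++ [ e ])) ⟧ * h s) (exchange (w e) (w d) (W cs)))))
        (openCycle-rec ℓ e d (λ m → h (w d ℕ.+ m)))))

  ∑-closed : ∀ ℓ c h → ∑[ cs ← words colours ℓ ] (⟦ allDiffer (pairs (c ∷ cs ++ [ c ])) ⟧ * h (W cs)) ≡ closedSum q ℓ (group c) h
  ∑-closed zero    c h = trans (openCycle-zero c c h) (cong (λ b → ⟦ not b ⟧ * h 0) (isYes⁺ (c Fin.≟ c) refl))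
  ∑-closed (suc ℓ) c h = begin
    openCycle (suc ℓ) c c h
      ≡⟨ isolate (openCycle (suc ℓ) c c h) _ ⟩
    openCycle (suc ℓ) c c h + openCycle ℓ c c (λ m → h (w c ℕ.+ m)) - openCycle ℓ c c (λ m → h (w c ℕ.+ m))
      ≡⟨ cong₂ _-_ (openCycle-rec ℓ c c h) (∑-closed ℓ c (λ m → h (w c ℕ.+ m))) ⟩
    closedSum q (suc ℓ) (group c) h ∎
    where
    open ≡-Reasoning
    isolate : ∀ a b → a ≡ a + b - b
    isolate = solve-∀

  -- The inner sums see the root colour only through its group, so its choice yields an exact factor
  -- q. Once this factor is cancelled, the congruences for the counts modulo q² and q³ become
  -- congruences for `rootedSum` modulo q and q².
  weightedCount-rootedSum : ∀ {n} {G : Graph n} (D : Decomposition G) f → let open Decomposition D in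
    weightedCount K w f G ≡ ℤ.+ q * (rootedSum q (length arc) (map length tentacles) f true
                                   + rootedSum q (length arc) (map length tentacles) f false)
  weightedCount-rootedSum {G = G} D f = begin
    weightedCount K w f G
      ≡⟨ weightedCount-decomposed D K w f ⟩
    ∑[ c ← colours ] ∑[ cs ← words colours (length arc) ] ∑[ ts ← wordLists colours ns ]
      (⟦ allDiffer (edges c cs ts) ⟧ * f (W (c ∷ concat (cs ∷ ts))))
      ≡⟨ ∑-cong colours (λ c → trans (∑-cong (words colours (length arc)) (perCycle c))
           (∑-closed (length arc) c (λ m → tentacleSum q ns (group c) (λ m′ → f (w c ℕ.+ (m ℕ.+ m′)))))) ⟩
    ∑[ c ← colours ] rootedSum q (length arc) ns f (group c)
      ≡⟨ ∑-group q (rootedSum q (length arc) ns f) ⟩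
    _ ∎
    where
    open ≡-Reasoning
    open Decomposition D
    ns = map length tentacles
    perCycle : ∀ c cs →
      ∑[ ts ← wordLists colours ns ] (⟦ allDiffer (edges c cs ts) ⟧ * f (W (c ∷ concat (cs ∷ ts))))
      ≡ ⟦ allDiffer (pairs (c ∷ cs ++ [ c ])) ⟧ * tentacleSum q ns (group c) (λ m′ → f (w c ℕ.+ (W cs ℕ.+ m′)))
    perCycle c cs = begin
      ∑[ ts ← wordLists colours ns ] (⟦ allDiffer (edges c cs ts) ⟧ * f (W (c ∷ concat (cs ∷ ts))))
        ≡⟨ ∑-cong (wordLists colours ns) (λ ts → trans
             (cong₂ (λ x s → x * f (w c ℕ.+ s)) (allDiffer-++ (pairs (c ∷ cs ++ [ c ])) (tied ts)) (W-++ cs (concat ts)))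
             (ℤₚ.*-assoc ⟦ allDiffer (pairs (c ∷ cs ++ [ c ])) ⟧ _ _)) ⟩
      ∑[ ts ← wordLists colours ns ] (⟦ allDiffer (pairs (c ∷ cs ++ [ c ])) ⟧ *
        (⟦ allDiffer (tied ts) ⟧ * f (w c ℕ.+ (W cs ℕ.+ W (concat ts)))))
        ≡⟨ ∑-*ˡ ⟦ allDiffer (pairs (c ∷ cs ++ [ c ])) ⟧ (wordLists colours ns) _ ⟩
      ⟦ allDiffer (pairs (c ∷ cs ++ [ c ])) ⟧ *
        ∑[ ts ← wordLists colours ns ] (⟦ allDiffer (tied ts) ⟧ * f (w c ℕ.+ (W cs ℕ.+ W (concat ts))))
        ≡⟨ cong (_*_ ⟦ allDiffer (pairs (c ∷ cs ++ [ c ])) ⟧) (∑-tentacles ns c (λ m′ → f (w c ℕ.+ (W cs ℕ.+ m′)))) ⟩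
      _ ∎
      where tied = concatMap (λ t → pairs (c ∷ t))

-- Expansion of the transfer functionals in q

infix 4 _≈_[_]

-- The quotient is explicit and the equation is solved for `a`, so matching on `refl` turns each
-- rule into a ring identity.
record _≈_[_] (a b M : ℤ) : Set where
  constructor _,_
  field
    quotient : ℤ
    equation : a ≡ b + M * quotient

≈-reflexive : ∀ {a b M : ℤ} → a ≡ b → a ≈ b [ M ]
≈-reflexive {a} {M = M} refl = 0ℤ , go a M
  where
  go : ∀ a M → a ≡ a + M * 0ℤ
  go = solve-∀

≈-sym : ∀ {a b M} → a ≈ b [ M ] → b ≈ a [ M ]
≈-sym {b = b} {M} (c , refl) = - c , go b M c
  where
  go : ∀ b M c → b ≡ b + M * c + M * - c
  go = solve-∀

≈-trans : ∀ {a b c M} → a ≈ b [ M ] → b ≈ c [ M ] → a ≈ c [ M ]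
≈-trans {c = c} {M} (x , refl) (y , refl) = y + x , go c M x y
  where
  go : ∀ c M x y → c + M * y + M * x ≡ c + M * (y + x)
  go = solve-∀

≈-+ : ∀ {a b c d M} → a ≈ b [ M ] → c ≈ d [ M ] → a + c ≈ b + d [ M ]
≈-+ {b = b} {d = d} {M} (x , refl) (y , refl) = x + y , go b d M x y
  where
  go : ∀ b d M x y → b + M * x + (d + M * y) ≡ b + d + M * (x + y)
  go = solve-∀

≈-*ˡ : ∀ {a b M} (k : ℤ) → a ≈ b [ M ] → k * a ≈ k * b [ M ]
≈-*ˡ {b = b} {M} k (x , refl) = k * x , go k b M x
  where
  go : ∀ k b M x → k * (b + M * x) ≡ k * b + M * (k * x)
  go = solve-∀

≈-- : ∀ {a b c d M} → a ≈ b [ M ] → c ≈ d [ M ] → a - c ≈ b - d [ M ]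
≈-- {b = b} {d = d} {M} (x , refl) (y , refl) = x - y , go b d M x y
  where
  go : ∀ b d M x y → b + M * x - (d + M * y) ≡ b - d + M * (x - y)
  go = solve-∀

≈-lift : ∀ {a b M} → a ≈ b [ M ] → M * a ≈ M * b [ M * M ]
≈-lift {b = b} {M} (x , refl) = x , go b M x
  where
  go : ∀ b M x → M * (b + M * x) ≡ M * b + M * M * x
  go = solve-∀

-- The modulus |a - b| + 1 suffices: a nonzero quotient would make the difference larger than
-- itself.
≈-for-all-moduli : ∀ {a b} → (∀ q → a ≈ b [ ℤ.+ suc q ]) → a ≡ b
≈-for-all-moduli {a} {b} h with h ℤ.∣ a - b ∣
... | c , eq = go c ℤ.∣ c ∣ refl eq
  where
  M = ℤ.+ suc ℤ.∣ a - b ∣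
  dropZero : ∀ b M → b + M * 0ℤ ≡ b
  dropZero = solve-∀
  cancel : ∀ x y → x + y - x ≡ y
  cancel = solve-∀
  go : ∀ c k → ℤ.∣ c ∣ ≡ k → a ≡ b + M * c → a ≡ b
  go c zero    c≡ eq = trans eq (trans (cong (λ c → b + M * c) (ℤₚ.∣i∣≡0⇒i≡0 c≡)) (dropZero b M))
  go c (suc k) c≡ eq = contradiction size (ℕₚ.<⇒≱ (ℕₚ.n<1+n ℤ.∣ a - b ∣))
    where
    open ≡-Reasoning
    size : suc ℤ.∣ a - b ∣ ≤ ℤ.∣ a - b ∣
    size = subst (suc ℤ.∣ a - b ∣ ≤_) (sym (begin
      ℤ.∣ a - b ∣                  ≡⟨ cong (λ t → ℤ.∣ t - b ∣) eq ⟩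
      ℤ.∣ b + M * c - b ∣          ≡⟨ cong ℤ.∣_∣ (cancel b (M * c)) ⟩
      ℤ.∣ M * c ∣                  ≡⟨ ℤₚ.abs-* M c ⟩
      suc ℤ.∣ a - b ∣ ℕ.* ℤ.∣ c ∣  ≡⟨ cong (ℕ._*_ (suc ℤ.∣ a - b ∣)) c≡ ⟩
      suc ℤ.∣ a - b ∣ ℕ.* suc k    ∎))
      (ℕₚ.m≤m*n (suc ℤ.∣ a - b ∣) (suc k))

-- The sign (-1)^n, which is the residue of (q - 1)^n modulo q.
ε : ℕ → ℤ
ε zero    = 1ℤ
ε (suc n) = - ε n

ε-+ : ∀ m n → ε (m ℕ.+ n) ≡ ε m * ε n
ε-+ zero    n = sym (ℤₚ.*-identityˡ (ε n))
ε-+ (suc m) n = trans (cong -_ (ε-+ m n)) (ℤₚ.neg-distribˡ-* (ε m) (ε n))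

ε*ε : ∀ n → ε n * ε n ≡ 1ℤ
ε*ε zero    = refl
ε*ε (suc n) = trans (go (ε n)) (ε*ε n)
  where
  go : ∀ a → - a * - a ≡ a * a
  go = solve-∀

-- The first-order patterns: the group changes exactly once, so a nonempty end segment of the path
-- lies in the group opposite to `b`. In the recursion the change comes either later or at the very
-- first vertex. The end segment is the piece cut off by deleting one edge.
pathDefect : ℕ → Bool → (ℕ → ℤ) → ℤ
pathDefect zero    b f = 0ℤ
pathDefect (suc ℓ) b f = pathDefect ℓ b (λ m → f (wt b ℕ.+ m)) + f (suc ℓ ℕ.* wt (not b))

-- Changes on two tentacles would cost q², so exactly one tentacle has a change and all others keep
-- the group of the root.
tentacleDefect : List ℕ → Bool → (ℕ → ℤ) → ℤ
tentacleDefect []       b f = 0ℤ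
tentacleDefect (ℓ ∷ ℓs) b f = tentacleDefect ℓs b (λ m → f (ℓ ℕ.* wt b ℕ.+ m))
                            + pathDefect ℓ b (λ m → f (m ℕ.+ sum ℓs ℕ.* wt b))

pathDefect-cong : ∀ ℓ b {f g} → (∀ m → f m ≡ g m) → pathDefect ℓ b f ≡ pathDefect ℓ b g
pathDefect-cong zero    b eq = refl
pathDefect-cong (suc ℓ) b eq = cong₂ _+_ (pathDefect-cong ℓ b (λ m → eq _)) (eq _)

tentacleDefect-cong : ∀ ns b {f g} → (∀ m → f m ≡ g m) → tentacleDefect ns b f ≡ tentacleDefect ns b g
tentacleDefect-cong []       b eq = refl
tentacleDefect-cong (ℓ ∷ ns) b eq = cong₂ _+_ (tentacleDefect-cong ns b (λ m → eq _)) (pathDefect-cong ℓ b (λ m → eq _))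

pathDefect-≈ : ∀ {M} ℓ b k {f g} → (∀ m → f m ≈ k * g m [ M ]) → pathDefect ℓ b f ≈ k * pathDefect ℓ b g [ M ]
pathDefect-≈ zero    b k eq = ≈-reflexive (sym (ℤₚ.*-zeroʳ k))
pathDefect-≈ (suc ℓ) b k eq = ≈-trans (≈-+ (pathDefect-≈ ℓ b k (λ m → eq _)) (eq _))
  (≈-reflexive (sym (ℤₚ.*-distribˡ-+ k _ _)))

module _ (q : ℕ) where
  private
    Q = ℤ.+ q

  -- The power (q - 1)^n. It must stay exact in terms of order zero when working modulo q²; inside a
  -- factor q its residue `ε` is enough.
  θ : ℕ → ℤ
  θ zero    = 1ℤ
  θ (suc n) = (Q - 1ℤ) * θ n

  θ-+ : ∀ m n → θ (m ℕ.+ n) ≡ θ m * θ n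
  θ-+ zero    n = sym (ℤₚ.*-identityˡ (θ n))
  θ-+ (suc m) n = trans (cong (_*_ (Q - 1ℤ)) (θ-+ m n)) (sym (ℤₚ.*-assoc (Q - 1ℤ) (θ m) (θ n)))

  θ≈ε : ∀ n → θ n ≈ ε n [ Q ]
  θ≈ε zero    = ≈-reflexive refl
  θ≈ε (suc n) with θ≈ε n
  ... | c , eq = ε n + (Q - 1ℤ) * c , trans (cong (_*_ (Q - 1ℤ)) eq) (go (ε n) Q c)
    where
    go : ∀ e Q c → (Q - 1ℤ) * (e + Q * c) ≡ - e + Q * (e + (Q - 1ℤ) * c)
    go = solve-∀

  pathSum-cong-≈ : ∀ {M} ℓ b {f g} → (∀ m → f m ≈ g m [ M ]) → pathSum q ℓ b f ≈ pathSum q ℓ b g [ M ]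
  pathSum-cong-≈ zero    b eq = eq 0
  pathSum-cong-≈ (suc ℓ) b eq = ≈-+ (≈-*ˡ (Q - 1ℤ) (pathSum-cong-≈ ℓ b (λ m → eq _)))
                                    (≈-*ˡ Q (pathSum-cong-≈ ℓ (not b) (λ m → eq _)))

  closedSum-cong-≈ : ∀ {M} ℓ b {f g} → (∀ m → f m ≈ g m [ M ]) → closedSum q ℓ b f ≈ closedSum q ℓ b g [ M ]
  closedSum-cong-≈ zero    b eq = ≈-reflexive refl
  closedSum-cong-≈ (suc ℓ) b eq = ≈-- (pathSum-cong-≈ (suc ℓ) b eq) (closedSum-cong-≈ ℓ b (λ m → eq _))

  pathSum-linear : ∀ ℓ b k (f g : ℕ → ℤ) → pathSum q ℓ b (λ m → f m + k * g m) ≡ pathSum q ℓ b f + k * pathSum q ℓ b g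
  pathSum-linear zero    b k f g = refl
  pathSum-linear (suc ℓ) b k f g = trans
    (cong₂ (λ x y → (Q - 1ℤ) * x + Q * y) (pathSum-linear ℓ b k _ _) (pathSum-linear ℓ (not b) k _ _))
    (go (Q - 1ℤ) Q k _ _ _ _)
    where
    go : ∀ P Q k x y z t → P * (x + k * y) + Q * (z + k * t) ≡ P * x + Q * z + k * (P * y + Q * t)
    go = solve-∀

  closedSum-linear : ∀ ℓ b k (f g : ℕ → ℤ) → closedSum q ℓ b (λ m → f m + k * g m) ≡ closedSum q ℓ b f + k * closedSum q ℓ b g
  closedSum-linear zero    b k f g = sym (trans (ℤₚ.+-identityˡ _) (ℤₚ.*-zeroʳ k))
  closedSum-linear (suc ℓ) b k f g = trans
    (cong₂ _-_ (pathSum-linear (suc ℓ) b k f g) (closedSum-linear ℓ b k _ _))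
    (go k (pathSum q (suc ℓ) b f) (pathSum q (suc ℓ) b g) _ _)
    where
    go : ∀ k x y z t → x + k * y - (z + k * t) ≡ x - z + k * (y - t)
    go = solve-∀

  -- Modulo q the path cannot leave the group `b`, and each of its ℓ vertices contributes q - 1,
  -- that is -1.
  pathSum-≈ : ∀ ℓ b f → pathSum q ℓ b f ≈ ε ℓ * f (ℓ ℕ.* wt b) [ Q ]
  pathSum-≈ zero    b f = ≈-reflexive (sym (ℤₚ.*-identityˡ (f 0)))
  pathSum-≈ (suc ℓ) b f with pathSum-≈ ℓ b (λ m → f (wt b ℕ.+ m))
  ... | c , eq = _ , trans (cong (λ x → (Q - 1ℤ) * x + Q * Y) eq) (go Q (ε ℓ) c (f (suc ℓ ℕ.* wt b)) Y)
    where
    Y = pathSum q ℓ (not b) (λ m → f (wt (not b) ℕ.+ m))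
    go : ∀ Q e c x y → (Q - 1ℤ) * (e * x + Q * c) + Q * y ≡ - e * x + Q * (e * x + (Q - 1ℤ) * c + y)
    go = solve-∀

  -- A pattern with one change has weight q(q - 1)^(ℓ - 1), hence the sign (-1)^(ℓ - 1). Writing it
  -- as `ε (suc ℓ)` covers ℓ = 0 as well, where the defect is zero.
  pathSum-≈² : ∀ ℓ b f → pathSum q ℓ b f ≈ θ ℓ * f (ℓ ℕ.* wt b) + Q * (ε (suc ℓ) * pathDefect ℓ b f) [ Q * Q ]
  pathSum-≈² zero    b f = ≈-reflexive (go (f 0) Q)
    where
    go : ∀ x Q → x ≡ 1ℤ * x + Q * (- 1ℤ * 0ℤ)
    go = solve-∀
  pathSum-≈² (suc ℓ) b f
    with pathSum-≈² ℓ b (λ m → f (wt b ℕ.+ m)) | pathSum-≈ ℓ (not b) (λ m → f (wt (not b) ℕ.+ m))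
  ... | c , eq | d , eq′ = _ , trans (cong₂ (λ x y → (Q - 1ℤ) * x + Q * y) eq eq′)
    (go Q (θ ℓ) (ε ℓ) c d (f (suc ℓ ℕ.* wt b)) (pathDefect ℓ b (λ m → f (wt b ℕ.+ m))) (f (suc ℓ ℕ.* wt (not b))))
    where
    go : ∀ Q t e c d x u y →
      (Q - 1ℤ) * (t * x + Q * (- e * u) + Q * Q * c) + Q * (e * y + Q * d)
      ≡ (Q - 1ℤ) * t * x + Q * (- - e * (u + y)) + Q * Q * (- e * u + (Q - 1ℤ) * c + d)
    go = solve-∀

  tentacleSum-≈ : ∀ ns b f → tentacleSum q ns b f ≈ ε (sum ns) * f (sum ns ℕ.* wt b) [ Q ]
  tentacleSum-≈ []       b f = ≈-reflexive (sym (ℤₚ.*-identityˡ (f 0)))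
  tentacleSum-≈ (ℓ ∷ ns) b f = ≈-trans (pathSum-≈ ℓ b _)
    (≈-trans (≈-*ˡ (ε ℓ) (tentacleSum-≈ ns b _)) (≈-reflexive (begin
      ε ℓ * (ε (sum ns) * f (ℓ ℕ.* wt b ℕ.+ sum ns ℕ.* wt b))
        ≡⟨ ℤₚ.*-assoc (ε ℓ) (ε (sum ns)) _ ⟨
      ε ℓ * ε (sum ns) * f (ℓ ℕ.* wt b ℕ.+ sum ns ℕ.* wt b)
        ≡⟨ cong₂ (λ x y → x * f y) (ε-+ ℓ (sum ns)) (ℕₚ.*-distribʳ-+ (wt b) ℓ (sum ns)) ⟨
      ε (ℓ ℕ.+ sum ns) * f ((ℓ ℕ.+ sum ns) ℕ.* wt b) ∎)))
    where open ≡-Reasoning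

  tentacleSum-≈² : ∀ ns b f → tentacleSum q ns b f
    ≈ θ (sum ns) * f (sum ns ℕ.* wt b) + Q * (ε (suc (sum ns)) * tentacleDefect ns b f) [ Q * Q ]
  tentacleSum-≈² []       b f = ≈-reflexive (go (f 0) Q)
    where
    go : ∀ x Q → x ≡ 1ℤ * x + Q * (- 1ℤ * 0ℤ)
    go = solve-∀
  tentacleSum-≈² (ℓ ∷ ns) b f
    with pathSum-≈² ℓ b (λ m → tentacleSum q ns b (λ m′ → f (m ℕ.+ m′)))
       | tentacleSum-≈² ns b (λ m → f (ℓ ℕ.* wt b ℕ.+ m))
       | pathDefect-≈ ℓ b (ε (sum ns)) (λ m → tentacleSum-≈ ns b (λ m′ → f (m ℕ.+ m′)))
       | θ≈ε ℓ
  ... | c₁ , eq₁ | c₂ , eq₂ | c₃ , eq₃ | c₄ , eq₄ = _ , (begin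
      tentacleSum q (ℓ ∷ ns) b f
        ≡⟨ eq₁ ⟩
      θ ℓ * _ + Q * (- ε ℓ * _) + Q * Q * c₁
        ≡⟨ cong₂ (λ x y → θ ℓ * x + Q * (- ε ℓ * y) + Q * Q * c₁) eq₂ eq₃ ⟩
      θ ℓ * (θ s * x + Q * (- ε s * u) + Q * Q * c₂) + Q * (- ε ℓ * (ε s * v + Q * c₃)) + Q * Q * c₁
        ≡⟨ expand Q (θ ℓ) (θ s) (ε s) (ε ℓ) x u v c₁ c₂ c₃ ⟩
      θ ℓ * θ s * x + Q * - (θ ℓ * (ε s * u) + ε ℓ * ε s * v) + Q * Q * (θ ℓ * c₂ - ε ℓ * c₃ + c₁)
        -- Only the `θ ℓ` that already stands inside a factor `Q` is replaced by `ε ℓ`, with an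
        -- error of order Q². The leading product `θ ℓ * θ s` remains exact.
        ≡⟨ cong (λ t → θ ℓ * θ s * x + Q * - (t * (ε s * u) + ε ℓ * ε s * v) + Q * Q * (θ ℓ * c₂ - ε ℓ * c₃ + c₁)) eq₄ ⟩
      θ ℓ * θ s * x + Q * - ((ε ℓ + Q * c₄) * (ε s * u) + ε ℓ * ε s * v) + Q * Q * (θ ℓ * c₂ - ε ℓ * c₃ + c₁)
        ≡⟨ collect Q (θ ℓ * θ s) (ε s) (ε ℓ) x u v c₄ (θ ℓ * c₂ - ε ℓ * c₃ + c₁) ⟩
      θ ℓ * θ s * x + Q * (- (ε ℓ * ε s) * (u + v)) + Q * Q * c₅
        ≡⟨ cong₂ (λ y z → y * x + Q * (- z * (u + v)) + Q * Q * c₅) (θ-+ ℓ s) (ε-+ ℓ s) ⟨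
      θ (ℓ ℕ.+ s) * x + Q * (- ε (ℓ ℕ.+ s) * (u + v)) + Q * Q * c₅
        ≡⟨ cong (λ y → θ (ℓ ℕ.+ s) * f y + Q * (- ε (ℓ ℕ.+ s) * (u + v)) + Q * Q * c₅) (ℕₚ.*-distribʳ-+ (wt b) ℓ s) ⟨
      θ (ℓ ℕ.+ s) * f ((ℓ ℕ.+ s) ℕ.* wt b) + Q * (- ε (ℓ ℕ.+ s) * (u + v)) + Q * Q * c₅ ∎)
    where
    open ≡-Reasoning
    s = sum ns
    x = f (ℓ ℕ.* wt b ℕ.+ s ℕ.* wt b)
    u = tentacleDefect ns b (λ m → f (ℓ ℕ.* wt b ℕ.+ m))
    v = pathDefect ℓ b (λ m → f (m ℕ.+ s ℕ.* wt b))
    c₅ = - (c₄ * (ε s * u)) + (θ ℓ * c₂ - ε ℓ * c₃ + c₁)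
    expand : ∀ Q t t′ e e′ x u v c₁ c₂ c₃ →
      t * (t′ * x + Q * (- e * u) + Q * Q * c₂) + Q * (- e′ * (e * v + Q * c₃)) + Q * Q * c₁
      ≡ t * t′ * x + Q * - (t * (e * u) + e′ * e * v) + Q * Q * (t * c₂ - e′ * c₃ + c₁)
    expand = solve-∀
    collect : ∀ Q t e e′ x u v c d →
      t * x + Q * - ((e′ + Q * c) * (e * u) + e′ * e * v) + Q * Q * d
      ≡ t * x + Q * (- (e′ * e) * (u + v)) + Q * Q * (- (c * (e * u)) + d)
    collect = solve-∀

  -- Unrolled, the recursion is an alternating sum of path sums of lengths 1 to ℓ, each padded with
  -- vertices of the root's group. Modulo q they all give the same signed term, whence the factor ℓ,
  -- one less than the girth.
  closedSum-≈ : ∀ ℓ b h → closedSum q ℓ b h ≈ ε ℓ * (ℤ.+ ℓ * h (ℓ ℕ.* wt b)) [ Q ]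
  closedSum-≈ zero    b h = ≈-reflexive refl
  closedSum-≈ (suc ℓ) b h = ≈-trans (≈-- (pathSum-≈ (suc ℓ) b h) (closedSum-≈ ℓ b (λ m → h (wt b ℕ.+ m))))
    (≈-reflexive (go (ε ℓ) (ℤ.+ ℓ) (h (suc ℓ ℕ.* wt b))))
    where
    go : ∀ e l x → - e * x - e * (l * x) ≡ - e * ((1ℤ + l) * x)
    go = solve-∀

  rootedSum-≈ : ∀ ℓ ns f b → rootedSum q ℓ ns f b
    ≈ ε ℓ * (ℤ.+ ℓ * (ε (sum ns) * f (wt b ℕ.+ (ℓ ℕ.* wt b ℕ.+ sum ns ℕ.* wt b)))) [ Q ]
  rootedSum-≈ ℓ ns f b = ≈-trans (closedSum-cong-≈ ℓ b (λ m → tentacleSum-≈ ns b (λ m′ → f (wt b ℕ.+ (m ℕ.+ m′)))))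
    (closedSum-≈ ℓ b _)

  -- The colourings in which all tentacles keep the group of the root, while the cycle may change
  -- group freely. The tentacles enter only through their total length `s`.
  leading : ℕ → ℕ → (ℕ → ℤ) → Bool → ℤ
  leading ℓ s f b = closedSum q ℓ b (λ m → θ s * f (wt b ℕ.+ (m ℕ.+ s ℕ.* wt b)))

  -- The tentacle defect already carries a factor q, so the cycle around it is needed only modulo q;
  -- `≈-lift` restores the precision q².
  rootedSum-≈² : ∀ ℓ ns f b → rootedSum q ℓ ns f b ≈ leading ℓ (sum ns) f b
    + Q * (ε ℓ * (ℤ.+ ℓ * (ε (suc (sum ns)) * tentacleDefect ns b (λ m → f (wt b ℕ.+ (ℓ ℕ.* wt b ℕ.+ m)))))) [ Q * Q ]
  rootedSum-≈² ℓ ns f b = ≈-trans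
    (closedSum-cong-≈ ℓ b (λ m → tentacleSum-≈² ns b (λ m′ → f (wt b ℕ.+ (m ℕ.+ m′)))))
    (≈-trans (≈-reflexive (closedSum-linear ℓ b Q _ _))
             (≈-+ (≈-reflexive {leading ℓ (sum ns) f b} refl) (≈-lift (closedSum-≈ ℓ b _))))

-- The order, the girth and the tentacle lengths from the weighted counts

open Algebra.Properties.AbelianGroup ℤₚ.+-0-abelianGroup using () renaming (∙-cancelˡ to ℤ-cancelˡ)

exactly : ℕ → ℕ → ℤ
exactly k m = ⟦ ⌊ m ℕ.≟ k ⌋ ⟧

isYes-cong : {P R : Set} (d : Dec P) (e : Dec R) → (P → R) → (R → P) → ⌊ d ⌋ ≡ ⌊ e ⌋
isYes-cong d e f g = Bool-ext (λ eq → isYes⁺ e (f (isYes⁻ d eq))) (λ eq → isYes⁺ d (g (isYes⁻ e eq)))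

exactly-cong : ∀ {k m k′ m′} → (m ≡ k → m′ ≡ k′) → (m′ ≡ k′ → m ≡ k) → exactly k m ≡ exactly k′ m′
exactly-cong {k} {m} {k′} {m′} f g = cong ⟦_⟧ (isYes-cong (m ℕ.≟ k) (m′ ℕ.≟ k′) f g)

longer : ℕ → List ℕ → ℕ
longer j []       = 0
longer j (ℓ ∷ ℓs) = (if ⌊ j ℕ.≤? ℓ ⌋ then 1 else 0) ℕ.+ longer j ℓs

≤?-suc : ∀ j ℓ → ⟦ ⌊ j ℕ.≤? ℓ ⌋ ⟧ + exactly j (suc ℓ) ≡ ⟦ ⌊ j ℕ.≤? suc ℓ ⌋ ⟧
≤?-suc j ℓ with j ℕ.≤? ℓ | suc ℓ ℕ.≟ j | j ℕ.≤? suc ℓ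
... | yes j≤ | yes refl | _      = contradiction j≤ ℕₚ.1+n≰n
... | yes j≤ | no _     | yes _  = refl
... | yes j≤ | no _     | no j≰  = contradiction (ℕₚ.m≤n⇒m≤1+n j≤) j≰
... | no _   | yes refl | yes _  = refl
... | no _   | yes refl | no j≰  = contradiction ℕₚ.≤-refl j≰
... | no j≰  | no j≢    | yes j≤ = contradiction (ℕₚ.≤-pred (ℕₚ.≤∧≢⇒< j≤ (j≢ ∘ sym))) j≰
... | no _   | no _     | no _   = refl

-- When the path starts from the first group, the switched segment is what is missing from the
-- weight ℓ. The additive test picks the segment of exactly j vertices, which occurs once precisely
-- when it fits. The case j = 0 is excluded since a defect has a nonempty segment.
pathDefect-true : ∀ {j} ℓ → 1 ≤ j → pathDefect ℓ true (λ m → exactly ℓ (m ℕ.+ j)) ≡ ⟦ ⌊ j ℕ.≤? ℓ ⌋ ⟧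
pathDefect-true {j} zero    1≤j = cong ⟦_⟧ (sym (isYes-no (j ℕ.≤? 0) (ℕₚ.<⇒≱ 1≤j)))
pathDefect-true {j} (suc ℓ) 1≤j = trans
  (cong₂ _+_
    (trans (pathDefect-cong ℓ true (λ m → exactly-cong ℕₚ.suc-injective (cong suc))) (pathDefect-true ℓ 1≤j))
    (exactly-cong {suc ℓ} {suc ℓ ℕ.* 0 ℕ.+ j} {j} {suc ℓ}
      (λ eq → sym (trans (sym (absorb ℓ j)) eq)) (λ eq → trans (absorb ℓ j) (sym eq))))
  (≤?-suc j ℓ)
  where
  absorb : ∀ ℓ j → suc ℓ ℕ.* 0 ℕ.+ j ≡ j
  absorb ℓ j = cong (ℕ._+ j) (ℕₚ.*-zeroʳ (suc ℓ))

-- When the path starts from the second group, the switched segment carries the whole weight, so it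
-- has k vertices.
pathDefect-false : ∀ {k} ℓ → 1 ≤ k → pathDefect ℓ false (exactly k) ≡ ⟦ ⌊ k ℕ.≤? ℓ ⌋ ⟧
pathDefect-false {k} zero    1≤k = cong ⟦_⟧ (sym (isYes-no (k ℕ.≤? 0) (ℕₚ.<⇒≱ 1≤k)))
pathDefect-false {k} (suc ℓ) 1≤k = trans
  (cong₂ _+_ (pathDefect-false ℓ 1≤k) (cong (exactly k) (ℕₚ.*-identityʳ (suc ℓ))))
  (≤?-suc k ℓ)

longer-step : ∀ j ℓ ℓs → ℤ.+ longer j ℓs + ⟦ ⌊ j ℕ.≤? ℓ ⌋ ⟧ ≡ ℤ.+ longer j (ℓ ∷ ℓs)
longer-step j ℓ ℓs = trans (ℤₚ.+-comm (ℤ.+ longer j ℓs) ⟦ ⌊ j ℕ.≤? ℓ ⌋ ⟧) (cong (_+ ℤ.+ longer j ℓs) (sym (pos-indicator ⌊ j ℕ.≤? ℓ ⌋)))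

tentacleDefect-true : ∀ {j} ns → 1 ≤ j →
  tentacleDefect ns true (λ m → exactly (sum ns) (m ℕ.+ j)) ≡ ℤ.+ longer j ns
tentacleDefect-true     []       1≤j = refl
tentacleDefect-true {j} (ℓ ∷ ns) 1≤j = trans
  (cong₂ _+_
    (trans (tentacleDefect-cong ns true (λ m → exactly-cong
              (λ eq → ℕₚ.+-cancelˡ-≡ ℓ _ _ (trans (sym (assoc₁ ℓ m j)) eq))
              (λ eq → trans (assoc₁ ℓ m j) (cong (ℕ._+_ ℓ) eq))))
           (tentacleDefect-true ns 1≤j))
    (trans (pathDefect-cong ℓ true (λ m → exactly-cong
              (λ eq → ℕₚ.+-cancelʳ-≡ (sum ns) _ _ (trans (sym (assoc₂ m (sum ns) j)) eq))
              (λ eq → trans (assoc₂ m (sum ns) j) (cong (ℕ._+ sum ns) eq))))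
           (pathDefect-true ℓ 1≤j)))
  (longer-step j ℓ ns)
  where
  assoc₁ : ∀ ℓ m j → ℓ ℕ.* 1 ℕ.+ m ℕ.+ j ≡ ℓ ℕ.+ (m ℕ.+ j)
  assoc₁ = ℕ-Solver.solve-∀
  assoc₂ : ∀ m s j → m ℕ.+ s ℕ.* 1 ℕ.+ j ≡ m ℕ.+ j ℕ.+ s
  assoc₂ = ℕ-Solver.solve-∀

tentacleDefect-false : ∀ {k} ns → 1 ≤ k → tentacleDefect ns false (exactly k) ≡ ℤ.+ longer k ns
tentacleDefect-false     []       1≤k = refl
tentacleDefect-false {k} (ℓ ∷ ns) 1≤k = trans
  (cong₂ _+_
    (trans (tentacleDefect-cong ns false (λ m → cong (λ z → exactly k (z ℕ.+ m)) (ℕₚ.*-zeroʳ ℓ)))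
           (tentacleDefect-false ns 1≤k))
    (trans (pathDefect-cong ℓ false (λ m → cong (exactly k) (trans (cong (ℕ._+_ m) (ℕₚ.*-zeroʳ (sum ns))) (ℕₚ.+-identityʳ m))))
           (pathDefect-false ℓ 1≤k)))
  (longer-step k ℓ ns)

-- Groups have `suc q` colours because the factor contributed by the root colour has to be
-- cancelled.
SameSums : ℕ → List ℕ → ℕ → List ℕ → Set
SameSums ℓ ns ℓ′ ns′ = ∀ q f →
  rootedSum (suc q) ℓ ns f true + rootedSum (suc q) ℓ ns f false
  ≡ rootedSum (suc q) ℓ′ ns′ f true + rootedSum (suc q) ℓ′ ns′ f false

rootedValue : ℕ → ℕ → (ℕ → ℤ) → Bool → ℤ
rootedValue ℓ s f b = ε ℓ * (ℤ.+ ℓ * (ε s * f (wt b ℕ.+ (ℓ ℕ.* wt b ℕ.+ s ℕ.* wt b))))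

-- At this order the whole graph lies in the group of the root. A root in the second group gives
-- weight 0, which the positive target `suc k` rules out, so a single term survives.
rootedValue-exactly : ∀ ℓ s k → rootedValue ℓ s (exactly (suc k)) true + rootedValue ℓ s (exactly (suc k)) false
  ≡ ε (ℓ ℕ.+ s) * (ℤ.+ ℓ * exactly (suc k) (suc (ℓ ℕ.+ s)))
rootedValue-exactly ℓ s k = begin
  rootedValue ℓ s (exactly (suc k)) true + rootedValue ℓ s (exactly (suc k)) false
    ≡⟨ cong₂ (λ x y → ε ℓ * (ℤ.+ ℓ * (ε s * exactly (suc k) (suc x))) + ε ℓ * (ℤ.+ ℓ * (ε s * exactly (suc k) y)))
         (one ℓ s) (zer ℓ s) ⟩
  ε ℓ * (ℤ.+ ℓ * (ε s * exactly (suc k) (suc (ℓ ℕ.+ s)))) + ε ℓ * (ℤ.+ ℓ * (ε s * 0ℤ))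
    ≡⟨ tidy (ε ℓ) (ℤ.+ ℓ) (ε s) _ ⟩
  ε ℓ * ε s * (ℤ.+ ℓ * exactly (suc k) (suc (ℓ ℕ.+ s)))
    ≡⟨ cong (_* (ℤ.+ ℓ * exactly (suc k) (suc (ℓ ℕ.+ s)))) (ε-+ ℓ s) ⟨
  ε (ℓ ℕ.+ s) * (ℤ.+ ℓ * exactly (suc k) (suc (ℓ ℕ.+ s))) ∎
  where
  open ≡-Reasoning
  one : ∀ ℓ s → ℓ ℕ.* 1 ℕ.+ s ℕ.* 1 ≡ ℓ ℕ.+ s
  one = ℕ-Solver.solve-∀
  zer : ∀ ℓ s → ℓ ℕ.* 0 ℕ.+ s ℕ.* 0 ≡ 0
  zer = ℕ-Solver.solve-∀
  tidy : ∀ e l e′ x → e * (l * (e′ * x)) + e * (l * (e′ * 0ℤ)) ≡ e * e′ * (l * x)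
  tidy = solve-∀

ε-cancel : ∀ n {x y} → ε n * x ≡ ε n * y → x ≡ y
ε-cancel n {x} {y} eq = trans (sym (undo x)) (trans (cong (_*_ (ε n)) eq) (undo y))
  where
  undo : ∀ z → ε n * (ε n * z) ≡ z
  undo z = trans (sym (ℤₚ.*-assoc (ε n) (ε n) z)) (trans (cong (_* z) (ε*ε n)) (ℤₚ.*-identityˡ z))

*-exactly : ∀ l {k m} → m ≡ k → ℤ.+ l * exactly k m ≡ ℤ.+ l
*-exactly l {k} {m} eq = trans (cong (λ b → ℤ.+ l * ⟦ b ⟧) (isYes⁺ (m ℕ.≟ k) eq)) (ℤₚ.*-identityʳ (ℤ.+ l))

module _ (ℓ : ℕ) (ns : List ℕ) (ℓ′ : ℕ) (ns′ : List ℕ) (same : SameSums ℓ ns ℓ′ ns′) where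

  sameValue : ∀ f → rootedValue ℓ (sum ns) f true + rootedValue ℓ (sum ns) f false
                  ≡ rootedValue ℓ′ (sum ns′) f true + rootedValue ℓ′ (sum ns′) f false
  sameValue f = ≈-for-all-moduli λ q →
    ≈-trans (≈-sym (≈-+ (rootedSum-≈ (suc q) ℓ ns f true) (rootedSum-≈ (suc q) ℓ ns f false)))
    (≈-trans (≈-reflexive (same q f))
             (≈-+ (rootedSum-≈ (suc q) ℓ′ ns′ f true) (rootedSum-≈ (suc q) ℓ′ ns′ f false)))

  private
    s  = sum ns
    s′ = sum ns′

    total≡ : ε (ℓ ℕ.+ s) * (ℤ.+ ℓ * exactly (suc (ℓ ℕ.+ s)) (suc (ℓ ℕ.+ s)))
           ≡ ε (ℓ′ ℕ.+ s′) * (ℤ.+ ℓ′ * exactly (suc (ℓ ℕ.+ s)) (suc (ℓ′ ℕ.+ s′)))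
    total≡ = trans (sym (rootedValue-exactly ℓ s (ℓ ℕ.+ s)))
      (trans (sameValue (exactly (suc (ℓ ℕ.+ s)))) (rootedValue-exactly ℓ′ s′ (ℓ ℕ.+ s)))

    total≡ˡ : ε (ℓ ℕ.+ s) * ℤ.+ ℓ ≡ ε (ℓ′ ℕ.+ s′) * (ℤ.+ ℓ′ * exactly (suc (ℓ ℕ.+ s)) (suc (ℓ′ ℕ.+ s′)))
    total≡ˡ = trans (cong (_*_ (ε (ℓ ℕ.+ s))) (sym (*-exactly ℓ refl))) total≡

  -- Tested at the order of the first graph, the left side is ℓ up to sign and hence nonzero,
  -- whereas a different order would make the right side vanish. The order is one more than `ℓ + s`
  -- because of the root.
  sameOrder : 1 ≤ ℓ → ℓ ℕ.+ s ≡ ℓ′ ℕ.+ s′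
  sameOrder 1≤ℓ with ℓ ℕ.+ s ℕ.≟ ℓ′ ℕ.+ s′
  ... | yes eq = eq
  ... | no ≢   = contradiction (ℤₚ.+-injective (ε-cancel (ℓ ℕ.+ s) vanishing)) (λ ℓ≡0 → ℕₚ.<⇒≢ 1≤ℓ (sym ℓ≡0))
    where
    vanish : ∀ a b c → a * (b * 0ℤ) ≡ c * 0ℤ
    vanish = solve-∀
    vanishing : ε (ℓ ℕ.+ s) * ℤ.+ ℓ ≡ ε (ℓ ℕ.+ s) * 0ℤ
    vanishing = trans total≡ˡ (trans
      (cong (λ b → ε (ℓ′ ℕ.+ s′) * (ℤ.+ ℓ′ * ⟦ b ⟧))
        (isYes-no (suc (ℓ′ ℕ.+ s′) ℕ.≟ suc (ℓ ℕ.+ s)) (λ e → ≢ (ℕₚ.suc-injective (sym e)))))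
      (vanish (ε (ℓ′ ℕ.+ s′)) (ℤ.+ ℓ′) (ε (ℓ ℕ.+ s))))

  -- With equal orders the signs agree, and the same test value leaves the two arc lengths.
  sameGirth : 1 ≤ ℓ → ℓ ≡ ℓ′
  sameGirth 1≤ℓ = ℤₚ.+-injective (ε-cancel (ℓ ℕ.+ s) (trans total≡ˡ
    (cong₂ _*_ (cong ε (sym (sameOrder 1≤ℓ))) (*-exactly ℓ′ (cong suc (sym (sameOrder 1≤ℓ)))))))

-- The common leading terms `x` and `y` cancel exactly; dividing the remainder by the nonzero
-- `suc q` lowers the modulus from its square to itself.
≈-unlift : ∀ {q a b c d} x y →
  (x + ℤ.+ suc q * a) + (y + ℤ.+ suc q * b) ≈ (x + ℤ.+ suc q * c) + (y + ℤ.+ suc q * d) [ ℤ.+ suc q * ℤ.+ suc q ] →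
  a + b ≈ c + d [ ℤ.+ suc q ]
≈-unlift {q} {a} {b} {c} {d} x y (k , eq) = k , ℤₚ.*-cancelˡ-≡ (ℤ.+ suc q) _ _ (ℤ-cancelˡ (x + y) _ _
  (trans (left x y (ℤ.+ suc q) a b) (trans eq (right x y (ℤ.+ suc q) c d k))))
  where
  left : ∀ x y Q a b → x + y + Q * (a + b) ≡ x + Q * a + (y + Q * b)
  left = solve-∀
  right : ∀ x y Q a b c → x + Q * a + (y + Q * b) + Q * Q * c ≡ x + y + Q * (a + b + Q * c)
  right = solve-∀

module _ (ℓ : ℕ) (ns ns′ : List ℕ) (same : SameSums (suc ℓ) ns (suc ℓ) ns′) (sum≡ : sum ns ≡ sum ns′) where
  private
    s = sum ns
    L = suc ℓ

    shifted : (ℕ → ℤ) → Bool → ℕ → ℤ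
    shifted f b m = f (wt b ℕ.+ (L ℕ.* wt b ℕ.+ m))

    correction : List ℕ → (ℕ → ℤ) → Bool → ℤ
    correction ks f b = ε L * (ℤ.+ L * (ε (suc s) * tentacleDefect ks b (shifted f b)))

    expansion : ∀ q ks → sum ks ≡ s → ∀ f b →
      rootedSum q L ks f b ≈ leading q L s f b + ℤ.+ q * correction ks f b [ ℤ.+ q * ℤ.+ q ]
    expansion q ks eq f b = subst
      (λ t → rootedSum q L ks f b ≈ leading q L t f b
             + ℤ.+ q * (ε L * (ℤ.+ L * (ε (suc t) * tentacleDefect ks b (shifted f b)))) [ ℤ.+ q * ℤ.+ q ])
      eq (rootedSum-≈² q L ks f b)

  sameDefect : ∀ f → tentacleDefect ns true (shifted f true) + tentacleDefect ns false (shifted f false)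
                   ≡ tentacleDefect ns′ true (shifted f true) + tentacleDefect ns′ false (shifted f false)
  -- The common factor of the corrections is L up to sign, and L is a successor, so it can be
  -- cancelled.
  sameDefect f = ε-cancel (suc s) (ℤₚ.*-cancelˡ-≡ (ℤ.+ L) _ _ (ε-cancel L
    (trans (sym (factor ns)) (trans (≈-for-all-moduli corrections≈) (factor ns′)))))
    where
    pull : ∀ e l e′ x y → e * (l * (e′ * x)) + e * (l * (e′ * y)) ≡ e * (l * (e′ * (x + y)))
    pull = solve-∀
    factor : ∀ ks → correction ks f true + correction ks f false
      ≡ ε L * (ℤ.+ L * (ε (suc s) * (tentacleDefect ks true (shifted f true) + tentacleDefect ks false (shifted f false))))
    factor ks = pull (ε L) (ℤ.+ L) (ε (suc s)) _ _
    corrections≈ : ∀ q → correction ns f true + correction ns f false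
                       ≈ correction ns′ f true + correction ns′ f false [ ℤ.+ suc q ]
    corrections≈ q = ≈-unlift (leading (suc q) L s f true) (leading (suc q) L s f false) (≈-trans
      (≈-sym (≈-+ (expansion (suc q) ns refl f true) (expansion (suc q) ns refl f false)))
      (≈-trans (≈-reflexive (same q f))
               (≈-+ (expansion (suc q) ns′ (sym sum≡) f true) (expansion (suc q) ns′ (sym sum≡) f false))))

  -- Here j + k is the order. With k vertices in the first group, a root in that group means that a
  -- piece of size j was cut off, and a root in the second group means a piece of size k. The test
  -- function cannot separate the two cases, so their counts appear added.
  sameLonger : ∀ {j k} → 1 ≤ j → 1 ≤ k → j ℕ.+ k ≡ suc (L ℕ.+ sum ns) →
    longer j ns ℕ.+ longer k ns ≡ longer j ns′ ℕ.+ longer k ns′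
  sameLonger {j} {k} 1≤j 1≤k jk = ℤₚ.+-injective
    (trans (sym (evaluate ns refl)) (trans (sameDefect (exactly k)) (evaluate ns′ (sym sum≡))))
    where
    evaluate : ∀ ks → sum ks ≡ s →
      tentacleDefect ks true (shifted (exactly k) true) + tentacleDefect ks false (shifted (exactly k) false)
      ≡ ℤ.+ (longer j ks ℕ.+ longer k ks)
    evaluate ks eq = cong₂ _+_
      (trans (tentacleDefect-cong ks true (λ m → exactly-cong (to m) (from m))) (tentacleDefect-true ks 1≤j))
      (trans (tentacleDefect-cong ks false (λ m → cong (λ z → exactly k (z ℕ.+ m)) (ℕₚ.*-zeroʳ L))) (tentacleDefect-false ks 1≤k))
      where
      arrange : ∀ l m j → l ℕ.+ (m ℕ.+ j) ≡ j ℕ.+ (l ℕ.* 1 ℕ.+ m)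
      arrange = ℕ-Solver.solve-∀
      bump : ∀ j x → j ℕ.+ suc x ≡ suc (j ℕ.+ x)
      bump = ℕ-Solver.solve-∀
      to : ∀ m → suc (L ℕ.* 1 ℕ.+ m) ≡ k → m ℕ.+ j ≡ sum ks
      to m e = trans (ℕₚ.+-cancelˡ-≡ L _ _ (ℕₚ.suc-injective
        (trans (cong suc (arrange L m j)) (trans (sym (bump j _)) (trans (cong (ℕ._+_ j) e) jk))))) (sym eq)
      from : ∀ m → m ℕ.+ j ≡ sum ks → suc (L ℕ.* 1 ℕ.+ m) ≡ k
      from m e = ℕₚ.+-cancelˡ-≡ j _ _ (trans (bump j _)
        (trans (cong suc (sym (arrange L m j))) (trans (cong (λ z → suc (L ℕ.+ z)) (trans e eq)) (sym jk))))

-- Recovering a multiset of lengths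

longer-anti : ∀ {i j} ns → i ≤ j → longer j ns ≤ longer i ns
longer-anti []       i≤j = z≤n
longer-anti {i} {j} (ℓ ∷ ns) i≤j with j ℕ.≤? ℓ | i ℕ.≤? ℓ
... | yes _   | yes _  = s≤s (longer-anti ns i≤j)
... | yes j≤ℓ | no i≰ℓ = contradiction (ℕₚ.≤-trans i≤j j≤ℓ) i≰ℓ
... | no _    | yes _  = ℕₚ.m≤n⇒m≤1+n (longer-anti ns i≤j)
... | no _    | no _   = longer-anti ns i≤j

longer≥1⇒≤sum : ∀ {j} ns → 1 ≤ longer j ns → j ≤ sum ns
longer≥1⇒≤sum {j} (ℓ ∷ ns) h with j ℕ.≤? ℓ
... | yes j≤ℓ = ℕₚ.≤-trans j≤ℓ (ℕₚ.m≤m+n ℓ (sum ns))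
... | no _    = ℕₚ.≤-trans (longer≥1⇒≤sum ns h) (ℕₚ.m≤n+m (sum ns) ℓ)

-- Since i ≤ j, an entry that reaches j is among those reaching i; a second one of these remains,
-- and the two are separate summands.
longer≥2⇒+≤sum : ∀ {i j} ns → i ≤ j → 1 ≤ longer j ns → 2 ≤ longer i ns → i ℕ.+ j ≤ sum ns
longer≥2⇒+≤sum {i} {j} (ℓ ∷ ns) i≤j h₁ h₂ with j ℕ.≤? ℓ | i ℕ.≤? ℓ
... | yes j≤ℓ | yes _  = subst (_≤ ℓ ℕ.+ sum ns) (ℕₚ.+-comm j i) (ℕₚ.+-mono-≤ j≤ℓ (longer≥1⇒≤sum ns (ℕₚ.≤-pred h₂)))
... | yes j≤ℓ | no i≰ℓ = contradiction (ℕₚ.≤-trans i≤j j≤ℓ) i≰ℓ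
... | no _    | yes i≤ℓ = ℕₚ.+-mono-≤ i≤ℓ (longer≥1⇒≤sum ns h₁)
... | no _    | no _   = ℕₚ.≤-trans (longer≥2⇒+≤sum ns i≤j h₁ h₂) (ℕₚ.m≤n+m (sum ns) ℓ)

SameFolded : ℕ → List ℕ → List ℕ → Set
SameFolded n ns ns′ = ∀ {j k} → 1 ≤ j → 1 ≤ k → j ℕ.+ k ≡ n →
  longer j ns ℕ.+ longer k ns ≡ longer j ns′ ℕ.+ longer k ns′

-- At the largest j where the two counts differ, say longer j ns > longer j ns′, the folded equation makes
-- longer k ns′ ≥ 2 for k = n - j, hence longer (k - 1) ns ≥ 2 by maximality; but parts of lengths
-- at least k - 1 and j do not fit in sum ns < n - 1.
module _ {n : ℕ} where
  private
    AgreeAbove : ℕ → List ℕ → List ℕ → Set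
    AgreeAbove k ns ns′ = ∀ j → k ℕ.+ j ≡ n → k ≤ j → longer j ns ≡ longer j ns′

    not-above : ∀ {k} ns ns′ → suc (suc (sum ns)) ≤ n → SameFolded n ns ns′ → AgreeAbove k ns ns′ →
      ∀ j → suc k ℕ.+ j ≡ n → suc k ≤ j → ¬ (longer j ns′ < longer j ns)
    -- Here j = n - 1, and a single entry of that size already exceeds the sum.
    not-above {zero} ns _ small folded agree j eq k<j more =
      ℕₚ.<⇒≱ (subst (suc (suc (sum ns)) ≤_) (sym eq) small) (s≤s (longer≥1⇒≤sum ns (ℕₚ.≤-trans (s≤s z≤n) more)))
    not-above {suc k} ns ns′ small folded agree j eq k<j more = ℕₚ.<⇒≱ small (begin
      n                          ≡⟨ eq ⟨
      suc (suc k ℕ.+ j)          ≤⟨ s≤s (longer≥2⇒+≤sum ns (ℕₚ.<⇒≤ k<j) 1≤ (subst (2 ≤_) (sym agree-k) (ℕₚ.≤-trans 2≤ (longer-anti ns′ (ℕₚ.n≤1+n (suc k)))))) ⟩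
      suc (sum ns)               ∎)
      where
      open ℕₚ.≤-Reasoning
      1≤ : 1 ≤ longer j ns
      1≤ = ℕₚ.≤-trans (s≤s z≤n) more
      2≤ : 2 ≤ longer (suc (suc k)) ns′
      2≤ = ℕₚ.≤-trans (s≤s (ℕₚ.≤-trans 1≤ (longer-anti ns k<j))) (ℕₚ.≰⇒> λ le →
        ℕₚ.<-irrefl (sym (folded (s≤s z≤n) (ℕₚ.≤-trans (s≤s z≤n) k<j) eq)) (ℕₚ.+-mono-≤-< le more))
      agree-k : longer (suc k) ns ≡ longer (suc k) ns′
      agree-k = ℕₚ.+-cancelʳ-≡ (longer (suc j) ns) _ _ (trans
        (folded (s≤s z≤n) (s≤s z≤n) eq′)
        (cong (ℕ._+_ (longer (suc k) ns′)) (sym (agree (suc j) eq′ (ℕₚ.≤-trans (ℕₚ.<⇒≤ k<j) (ℕₚ.n≤1+n j))))))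
        where
        eq′ : suc k ℕ.+ suc j ≡ n
        eq′ = trans (ℕₚ.+-suc (suc k) j) eq

    -- Induction on k lowers j = n - k from n to the middle. No entry reaches n, and each further
    -- step uses the agreement at the next larger index only.
    agreeAbove : ∀ ns ns′ → suc (suc (sum ns)) ≤ n → suc (suc (sum ns′)) ≤ n → SameFolded n ns ns′ →
      ∀ k → AgreeAbove k ns ns′
    agreeAbove ns ns′ small small′ folded zero j refl _ = trans (none ns small) (sym (none ns′ small′))
      where
      none : ∀ ks → suc (suc (sum ks)) ≤ j → longer j ks ≡ 0
      none ks small = ℕₚ.n≤0⇒n≡0 (ℕₚ.≮⇒≥ λ 1≤ → ℕₚ.<⇒≱ (ℕₚ.<-trans (ℕₚ.n<1+n _) small) (longer≥1⇒≤sum ks 1≤))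
    agreeAbove ns ns′ small small′ folded (suc k) j eq k<j = ℕₚ.≤-antisym
      (ℕₚ.≮⇒≥ (not-above ns ns′ small folded (agreeAbove ns ns′ small small′ folded k) j eq k<j))
      (ℕₚ.≮⇒≥ (not-above ns′ ns small′ folded′ (agreeAbove ns′ ns small′ small folded′ k) j eq k<j))
      where
      folded′ : SameFolded n ns′ ns
      folded′ 1≤j 1≤k jk = sym (folded 1≤j 1≤k jk)

  folded⇒longer : ∀ ns ns′ → suc (suc (sum ns)) ≤ n → suc (suc (sum ns′)) ≤ n → SameFolded n ns ns′ →
    ∀ j → 1 ≤ j → longer j ns ≡ longer j ns′
  folded⇒longer ns ns′ small small′ folded j 1≤j with n ℕ.≤? j
  ... | yes n≤j = trans (none ns small) (sym (none ns′ small′))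
    where
    none : ∀ ks → suc (suc (sum ks)) ≤ n → longer j ks ≡ 0
    none ks small = ℕₚ.n≤0⇒n≡0 (ℕₚ.≮⇒≥ λ 1≤ →
      ℕₚ.<⇒≱ (ℕₚ.<-trans (ℕₚ.n<1+n _) (ℕₚ.≤-trans small n≤j)) (longer≥1⇒≤sum ks 1≤))
  ... | no n≰j with ℕₚ.m<n⇒0<n∸m (ℕₚ.≰⇒> n≰j) | ℕₚ.m+[n∸m]≡n (ℕₚ.<⇒≤ (ℕₚ.≰⇒> n≰j)) | ℕₚ.≤-total (n ℕ.∸ j) j
  ...   | _   | jk | inj₁ k≤j = agreeAbove ns ns′ small small′ folded (n ℕ.∸ j) j (trans (ℕₚ.+-comm (n ℕ.∸ j) j) jk) k≤j
  -- Below the middle, the folded equation transfers the agreement from the index n - j.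
  ...   | 1≤k | jk | inj₂ j≤k = ℕₚ.+-cancelʳ-≡ (longer (n ℕ.∸ j) ns) _ _ (trans (folded 1≤j 1≤k jk)
          (cong (ℕ._+_ (longer j ns′)) (sym (agreeAbove ns ns′ small small′ folded j (n ℕ.∸ j) jk j≤k))))

occurrences : ℕ → List ℕ → ℕ
occurrences x []       = 0
occurrences x (y ∷ ys) = (if ⌊ x ℕ.≟ y ⌋ then 1 else 0) ℕ.+ occurrences x ys

occurrences-↭ : ∀ x {xs ys} → xs ↭ ys → occurrences x xs ≡ occurrences x ys
occurrences-↭ x ↭.refl          = refl
occurrences-↭ x (↭.prep y p)    = cong (ℕ._+_ (if ⌊ x ℕ.≟ y ⌋ then 1 else 0)) (occurrences-↭ x p)
occurrences-↭ x (↭.swap {xs} {ys} y z p) rewrite occurrences-↭ x p =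
  exchange (if ⌊ x ℕ.≟ y ⌋ then 1 else 0) (if ⌊ x ℕ.≟ z ⌋ then 1 else 0) (occurrences x ys)
  where
  exchange : ∀ a b c → a ℕ.+ (b ℕ.+ c) ≡ b ℕ.+ (a ℕ.+ c)
  exchange = ℕ-Solver.solve-∀
occurrences-↭ x (↭.trans p q)   = trans (occurrences-↭ x p) (occurrences-↭ x q)

occurrences⇒∈ : ∀ x ys → 1 ≤ occurrences x ys → x ∈ ys
occurrences⇒∈ x (y ∷ ys) h with x ℕ.≟ y
... | yes refl = here refl
... | no _     = there (occurrences⇒∈ x ys h)

occurrences⇒↭ : ∀ xs ys → (∀ x → occurrences x xs ≡ occurrences x ys) → xs ↭ ys
occurrences⇒↭ []       []       eq = ↭.refl
occurrences⇒↭ []       (y ∷ ys) eq with trans (eq y) (cong (λ b → (if b then 1 else 0) ℕ.+ occurrences y ys) (isYes⁺ (y ℕ.≟ y) refl))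
... | ()
occurrences⇒↭ (x ∷ xs) ys       eq
  with ∈-∃++ (occurrences⇒∈ x ys (subst (1 ≤_) (trans
         (cong (λ b → (if b then 1 else 0) ℕ.+ occurrences x xs) (sym (isYes⁺ (x ℕ.≟ x) refl))) (eq x)) (s≤s z≤n)))
... | us , vs , refl = ↭.trans (↭.prep x (occurrences⇒↭ xs (us ++ vs) (λ z → ℕₚ.+-cancelˡ-≡ (if ⌊ z ℕ.≟ x ⌋ then 1 else 0) _ _
        (trans (eq z) (occurrences-↭ z (↭ₚ.shift x us vs)))))) (↭-sym (↭ₚ.shift x us vs))

longer-occurrences : ∀ j ns → longer j ns ≡ occurrences j ns ℕ.+ longer (suc j) ns
longer-occurrences j []       = refl
longer-occurrences j (ℓ ∷ ns) rewrite longer-occurrences j ns with j ℕ.≤? ℓ | j ℕ.≟ ℓ | suc j ℕ.≤? ℓ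
... | yes _  | yes refl | yes j<  = contradiction j< ℕₚ.1+n≰n
... | yes _  | yes _    | no _    = refl
... | yes _  | no _     | yes _   = sym (ℕₚ.+-suc (occurrences j ns) (longer (suc j) ns))
... | yes j≤ | no j≢    | no j≮   = contradiction (ℕₚ.≤∧≢⇒< j≤ j≢) j≮
... | no j≰  | yes refl | _       = contradiction ℕₚ.≤-refl j≰
... | no j≰  | no _     | yes j<  = contradiction (ℕₚ.<⇒≤ j<) j≰
... | no _   | no _     | no _    = refl

longer⇒↭ : ∀ {ns ns′} → All (1 ≤_) ns → All (1 ≤_) ns′ → (∀ j → 1 ≤ j → longer j ns ≡ longer j ns′) → ns ↭ ns′
longer⇒↭ {ns} {ns′} pos pos′ eq = occurrences⇒↭ ns ns′ same
  where
  no-zero : ∀ {ks} → All (1 ≤_) ks → occurrences 0 ks ≡ 0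
  no-zero []                          = refl
  no-zero {suc k ∷ ks} (s≤s _ ∷ pos) = no-zero pos
  same : ∀ j → occurrences j ns ≡ occurrences j ns′
  same zero    = trans (no-zero pos) (sym (no-zero pos′))
  same (suc j) = ℕₚ.+-cancelʳ-≡ (longer (suc (suc j)) ns) _ _ (begin
    occurrences (suc j) ns ℕ.+ longer (suc (suc j)) ns    ≡⟨ longer-occurrences (suc j) ns ⟨
    longer (suc j) ns                                     ≡⟨ eq (suc j) (s≤s z≤n) ⟩
    longer (suc j) ns′                                    ≡⟨ longer-occurrences (suc j) ns′ ⟩
    occurrences (suc j) ns′ ℕ.+ longer (suc (suc j)) ns′  ≡⟨ cong (ℕ._+_ (occurrences (suc j) ns′)) (eq (suc (suc j)) (s≤s z≤n)) ⟨
    occurrences (suc j) ns′ ℕ.+ longer (suc (suc j)) ns   ∎)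
    where open ≡-Reasoning

-- The structure of a squid

pairs-++ : (xs : List A) (x : A) (ys : List A) → pairs (xs ++ x ∷ ys) ≡ pairs (xs ++ [ x ]) ++ pairs (x ∷ ys)
pairs-++ []           x ys = refl
pairs-++ (a ∷ [])     x ys = refl
pairs-++ (a ∷ b ∷ xs) x ys = cong ((a , b) ∷_) (pairs-++ (b ∷ xs) x ys)

∈-pairs⁻ : (l : List A) {u w : A} → (u , w) ∈ pairs l → u ∈ l × w ∈ l
∈-pairs⁻ (x ∷ y ∷ l) (here refl) = here refl , there (here refl)
∈-pairs⁻ (x ∷ y ∷ l) (there e∈) with ∈-pairs⁻ (y ∷ l) e∈
... | u∈ , w∈ = there u∈ , there w∈

Linked⁻ : {R : A → A → Set} {l : List A} → Linked R l → ∀ {u w} → (u , w) ∈ pairs l → R u w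
Linked⁻ (r ∷ rs) (here refl) = r
Linked⁻ (r ∷ rs) (there e∈)  = Linked⁻ rs e∈

last-pair : (x : A) (l : List A) (u : A) → ∃[ p ] p ∈ x ∷ l × (p , u) ∈ pairs (x ∷ l ++ [ u ])
last-pair x []      u = x , here refl , here refl
last-pair x (y ∷ l) u with last-pair y l u
... | p , p∈ , e∈ = p , there p∈ , there e∈

closed-neighbours : {u : A} {ys : List A} → Unique (u ∷ ys) → 2 ≤ length ys →
  ∃[ p ] ∃[ s ] p ≢ s × (p , u) ∈ pairs (u ∷ ys ++ [ u ]) × (u , s) ∈ pairs (u ∷ ys ++ [ u ])
closed-neighbours {u = u} {ys = s ∷ y ∷ ys} (_ ∷ s∉ ∷ _) _ with last-pair y ys u
... | p , p∈ , e∈ = p , s , (λ p≡s → All.lookup s∉ p∈ (sym p≡s)) , there (there e∈) , here refl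
closed-neighbours {ys = s ∷ []} _ (s≤s ())

-- Cutting the cyclic list before `u` and exchanging the two blocks only permutes the vertices and
-- the edges.
rotate : {s u : A} {l : List A} → u ∈ s ∷ l →
  ∃[ ys ] (s ∷ l ↭ u ∷ ys × pairs (s ∷ l ++ [ s ]) ↭ pairs (u ∷ ys ++ [ u ]))
rotate {s = s} {u} u∈ with ∈-∃++ u∈
... | []     , bs , refl = bs , ↭.refl , ↭.refl
... | _ ∷ as , bs , refl = bs ++ s ∷ as , ↭ₚ.++-comm (s ∷ as) (u ∷ bs) , ↭.trans
  (↭.↭-reflexive (trans (cong pairs (Listₚ.++-assoc (s ∷ as) (u ∷ bs) [ s ])) (pairs-++ (s ∷ as) u (bs ++ [ s ]))))
  (↭.trans (↭ₚ.++-comm (pairs (s ∷ as ++ [ u ])) (pairs (u ∷ bs ++ [ s ])))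
    (↭.↭-reflexive (sym (trans (cong pairs (Listₚ.++-assoc (u ∷ bs) (s ∷ as) [ u ])) (pairs-++ (u ∷ bs) s (as ++ [ u ]))))))

Unique-resp-↭ : {xs ys : List A} → xs ↭ ys → Unique xs → Unique ys
Unique-resp-↭ p = ↭ₛₚ.Unique-resp-↭ (setoid _) (↭⇒↭ₛ p)

count-≥ : ∀ {n} (P : Fin n → Bool) {l} xs → Unique l → (∀ {x} → x ∈ l → x ∈ xs × P x ≡ true) →
  length l ≤ sum (map (λ w → if P w then 1 else 0) xs)
count-≥ P {[]}    xs _        h = z≤n
count-≥ P {x ∷ l} xs (x∉ ∷ un) h with ∈-∃++ (proj₁ (h (here refl)))
... | ys , zs , refl = subst (suc (length l) ≤_)
  (sym (trans (sum-↭ (↭ₚ.map⁺ _ (↭ₚ.shift x ys zs))) (cong (λ b → (if b then 1 else 0) ℕ.+ sum (map (λ w → if P w then 1 else 0) (ys ++ zs))) (proj₂ (h (here refl))))))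
  (s≤s (count-≥ P (ys ++ zs) un λ y∈ → elsewhere y∈ (↭ₚ.∈-resp-↭ (↭ₚ.shift x ys zs) (proj₁ (h (there y∈)))) , proj₂ (h (there y∈))))
  where
  elsewhere : ∀ {y} → y ∈ l → y ∈ x ∷ ys ++ zs → y ∈ ys ++ zs
  elsewhere y∈ (here refl) = contradiction refl (All.lookup x∉ y∈)
  elsewhere y∈ (there y∈′) = y∈′

Unique-length≤ : ∀ {n} {l : List (Fin n)} → Unique l → length l ≤ n
Unique-length≤ {n} un = ℕₚ.≤-trans (count-≥ (λ _ → true) (allFin n) un (λ _ → ∈-allFin _ , refl)) (countB≤ {n} (λ _ → true))

-- Growing the tentacles outwards from the cycle

module _ {n} (G : Graph n) where
  open import Data.List.Membership.DecPropositional (Fin._≟_ {n}) using (_∈?_)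

  Adj-sym : ∀ {u w} → Adj G u w → Adj G w u
  Adj-sym {u} {w} uw = trans (Graph.sym G w u) uw

  Adj-irrefl : ∀ {u} → ¬ Adj G u u
  Adj-irrefl {u} uu with trans (sym uu) (irrefl G u)
  ... | ()

  walk-invariant : {P : Fin n → Set} → (∀ {u w} → P u → Adj G u w → P w) → ∀ {a b} → P a → Walk G a b → P b
  walk-invariant closed p here         = p
  walk-invariant closed p (step uw ws) = walk-invariant closed (closed p uw) ws

  degree≥3 : ∀ {u a b c} → Adj G u a → Adj G u b → Adj G u c → a ≢ b → c ≢ a → c ≢ b → 2 < degree G u
  degree≥3 {u} {a} {b} {c} ua ub uc a≢b c≢a c≢b =
    count-≥ (adj G u) {c ∷ a ∷ b ∷ []} (allFin n) ((c≢a ∷ c≢b ∷ []) ∷ (a≢b ∷ []) ∷ [] ∷ [])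
      λ { (here refl) → ∈-allFin c , uc ; (there (here refl)) → ∈-allFin a , ua ; (there (there (here refl))) → ∈-allFin b , ub }

  module _ (v : Fin n) (only : ∀ w → 2 < degree G w → w ≡ v) where

    two-neighbours : ∀ {u a b w} → u ≢ v → Adj G u a → Adj G u b → a ≢ b → Adj G u w → w ≡ a ⊎ w ≡ b
    two-neighbours {u} {a} {b} {w} u≢v ua ub a≢b uw with w Fin.≟ a | w Fin.≟ b
    ... | yes w≡a | _       = inj₁ w≡a
    ... | no _    | yes w≡b = inj₂ w≡b
    ... | no w≢a  | no w≢b  = contradiction (only u (degree≥3 ua ub uw a≢b w≢a w≢b)) u≢v

    -- A vertex other than `v` has at most two neighbours, and the cycle through it already supplies
    -- two different ones.
    closed-saturated : ∀ {s l} → Unique (s ∷ l) → 2 ≤ length l →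
      (∀ {u w} → (u , w) ∈ pairs (s ∷ l ++ [ s ]) → Adj G u w) →
      ∀ {u w} → u ∈ s ∷ l → u ≢ v → Adj G u w → (u , w) ∈ pairs (s ∷ l ++ [ s ]) ⊎ (w , u) ∈ pairs (s ∷ l ++ [ s ])
    closed-saturated {s} {l} un long adjacent {u} {w} u∈ u≢v uw with rotate u∈
    ... | ys , perm , permE with closed-neighbours (Unique-resp-↭ perm un)
                                   (subst (2 ≤_) (ℕₚ.suc-injective (↭ₚ.↭-length perm)) long)
    ...   | p , q , p≢q , pu∈ , uq∈ with ↭ₚ.∈-resp-↭ (↭-sym permE) pu∈ | ↭ₚ.∈-resp-↭ (↭-sym permE) uq∈
    ...     | pu | uq with two-neighbours u≢v (Adj-sym (adjacent pu)) (adjacent uq) p≢q uw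
    ...       | inj₁ refl = inj₂ pu
    ...       | inj₂ refl = inj₁ uq

    -- `vis` lists the vertices explored so far and `p` is the one from which the new vertex `cur`
    -- is entered. By `saturated`, apart from the edge to `p` no edge leaves the tentacle.
    record Tentacle (vis : List (Fin n)) (p cur : Fin n) : Set where
      field
        tail      : List (Fin n)
        uniq      : Unique (cur ∷ tail)
        fresh     : ∀ {u} → u ∈ cur ∷ tail → u ∉ vis
        adjacent  : ∀ {u w} → (u , w) ∈ pairs (p ∷ cur ∷ tail) → Adj G u w
        saturated : ∀ {u w} → u ∈ cur ∷ tail → Adj G u w →
                    (u , w) ∈ pairs (p ∷ cur ∷ tail) ⊎ (w , u) ∈ pairs (p ∷ cur ∷ tail)

    record Tentacles (vis : List (Fin n)) : Set where
      field
        arms      : List (List (Fin n))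
        uniq      : Unique (concat arms)
        fresh     : ∀ {u} → u ∈ concat arms → u ∉ vis
        adjacent  : ∀ {u w} → (u , w) ∈ concatMap (λ t → pairs (v ∷ t)) arms → Adj G u w
        saturated : ∀ {u w} → u ∈ concat arms → Adj G u w →
                    (u , w) ∈ concatMap (λ t → pairs (v ∷ t)) arms ⊎ (w , u) ∈ concatMap (λ t → pairs (v ∷ t)) arms
        nonempty  : All (λ t → 1 ≤ length t) arms
        exhausts  : ∀ u → u ∈ vis ⊎ u ∈ concat arms

    -- `no-return` is the form in which uniqueness of the cycle is used: a cycle that leaves `v`
    -- through `u` must be the given one, so `u` lies on `C`.
    module _ (C : List (Fin n))
      (no-return : ∀ {u x l} → Unique (v ∷ u ∷ x ∷ l) → Linked (Adj G) (u ∷ x ∷ l ++ [ v ]) → Adj G v u → u ∈ C) where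

      -- back is the path from cur to v with both ends removed.
      grow : ∀ fuel vis p cur back → n ≤ fuel ℕ.+ length vis → Unique vis → v ∈ vis → (∀ {u} → u ∈ C → u ∈ vis) →
        cur ∉ vis → p ∈ vis → Adj G p cur →
        (∀ {u w} → u ∈ vis → u ≢ v → Adj G u w → w ∈ vis ⊎ (u ≡ p × w ≡ cur)) →
        Unique (v ∷ cur ∷ back) → Linked (Adj G) (cur ∷ back ++ [ v ]) → (∀ {u} → u ∈ back → u ∈ vis) → (back ≡ [] → p ≡ v) →
        Tentacle vis p cur
      -- Out of fuel, `cur ∷ vis` would be a list of more than n distinct vertices.
      grow zero vis p cur back enough un v∈ C⊆ cur∉ _ _ _ _ _ _ _ =
        contradiction enough (ℕₚ.<⇒≱ (Unique-length≤ {l = cur ∷ vis} (Allₚ.¬Any⇒All¬ vis cur∉ ∷ un)))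
      grow (suc fuel) vis p cur back enough un v∈ C⊆ cur∉ p∈ pcur sat unB linked back⊆ start
        with Finₚ.any? (λ y → (adj G cur y Bool.≟ true) ×-dec ¬? (y Fin.≟ p))
      ... | no none = record
        { tail      = []
        ; uniq      = [] ∷ []
        ; fresh     = λ { (here refl) → cur∉ }
        ; adjacent  = λ { (here refl) → pcur }
        ; saturated = λ { (here refl) uw → inj₂ (here (cong (_, cur) (only-p uw))) }
        }
        where
        only-p : ∀ {w} → Adj G cur w → w ≡ p
        only-p {w} uw with w Fin.≟ p
        ... | yes w≡p = w≡p
        ... | no w≢p  = contradiction (w , uw , w≢p) none
      ... | yes (y , cury , y≢p) = record
        { tail      = y ∷ T.tail
        ; uniq      = Allₚ.¬Any⇒All¬ _ (λ cur∈ → T.fresh cur∈ (here refl)) ∷ T.uniq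
        ; fresh     = λ { (here refl) → cur∉ ; (there u∈) u∈vis → T.fresh u∈ (there u∈vis) }
        ; adjacent  = λ { (here refl) → pcur ; (there e∈) → T.adjacent e∈ }
        ; saturated = saturated′
        }
        where
        cur≢v : cur ≢ v
        cur≢v refl = cur∉ v∈
        neighbours : ∀ {w} → Adj G cur w → w ≡ p ⊎ w ≡ y
        neighbours = two-neighbours cur≢v (Adj-sym pcur) cury (y≢p ∘ sym)
        -- If the path returned to the root, then either it has just left it, so that `y` is `p`, or
        -- it closes a cycle through `cur`; then `cur` lies on `C` and would have been visited.
        not-root : ∀ b → (b ≡ [] → p ≡ v) → Unique (v ∷ cur ∷ b) → Linked (Adj G) (cur ∷ b ++ [ v ]) → y ≢ v
        not-root []      start _  _  refl = y≢p (sym (start refl))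
        not-root (x ∷ l) _     un ln refl = cur∉ (C⊆ (no-return un ln (Adj-sym cury)))
        y≢v : y ≢ v
        y≢v = not-root back start unB linked
        y∉ : y ∉ vis
        -- A visited vertex other than the root has only visited neighbours, except for the step
        -- from `p` to `cur`; and `y` is not `p`.
        y∉ y∈ with sat y∈ y≢v (Adj-sym cury)
        ... | inj₁ cur∈      = cur∉ cur∈
        ... | inj₂ (y≡p , _) = y≢p y≡p
        y∉′ : y ∉ cur ∷ vis
        y∉′ (here refl) = Adj-irrefl cury
        y∉′ (there y∈)  = y∉ y∈
        sat′ : ∀ {u w} → u ∈ cur ∷ vis → u ≢ v → Adj G u w → w ∈ cur ∷ vis ⊎ (u ≡ cur × w ≡ y)
        sat′ (here refl) _ uw with neighbours uw
        ... | inj₁ refl = inj₁ (there p∈)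
        ... | inj₂ refl = inj₂ (refl , refl)
        sat′ (there u∈) u≢v uw with sat u∈ u≢v uw
        ... | inj₁ w∈         = inj₁ (there w∈)
        ... | inj₂ (_ , refl) = inj₁ (here refl)
        unB′ : Unique (v ∷ cur ∷ back) → Unique (v ∷ y ∷ cur ∷ back)
        unB′ (v∉ ∷ u) = ((y≢v ∘ sym) ∷ v∉)
          ∷ ((λ { refl → Adj-irrefl cury }) ∷ Allₚ.¬Any⇒All¬ back (y∉ ∘ back⊆)) ∷ u
        rec : Tentacle (cur ∷ vis) cur y
        rec = grow fuel (cur ∷ vis) cur y (cur ∷ back) (subst (n ≤_) (sym (ℕₚ.+-suc fuel (length vis))) enough)
          (Allₚ.¬Any⇒All¬ vis cur∉ ∷ un) (there v∈) (there ∘ C⊆) y∉′ (here refl) cury sat′ (unB′ unB) (Adj-sym cury ∷ linked)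
          (λ { (here refl) → here refl ; (there u∈) → there (back⊆ u∈) }) (λ ())
        module T = Tentacle rec
        saturated′ : ∀ {u w} → u ∈ cur ∷ y ∷ T.tail → Adj G u w →
          (u , w) ∈ pairs (p ∷ cur ∷ y ∷ T.tail) ⊎ (w , u) ∈ pairs (p ∷ cur ∷ y ∷ T.tail)
        saturated′ (here refl) uw with neighbours uw
        ... | inj₁ refl = inj₂ (here refl)
        ... | inj₂ refl = inj₁ (there (here refl))
        saturated′ (there u∈) uw = Sum.map there there (T.saturated u∈ uw)

      -- All neighbours of a visited vertex other than `v` are visited. Once `v` has no unvisited
      -- neighbour either, the visited set is closed under adjacency, and connectedness makes it
      -- everything.
      growAll : Connected G → ∀ fuel vis → n ≤ fuel ℕ.+ length vis → Unique vis → v ∈ vis → (∀ {u} → u ∈ C → u ∈ vis) →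
        (∀ {u w} → u ∈ vis → u ≢ v → Adj G u w → w ∈ vis) → Tentacles vis
      growAll conn fuel vis enough un v∈ C⊆ sat with Finₚ.any? (λ y → (adj G v y Bool.≟ true) ×-dec ¬? (y ∈? vis))
      growAll conn fuel vis enough un v∈ C⊆ sat | no none = record
        { arms = [] ; uniq = [] ; fresh = λ () ; adjacent = λ () ; saturated = λ () ; nonempty = []
        ; exhausts = λ u → inj₁ (walk-invariant visited v∈ (conn v u)) }
        where
        visited : ∀ {u w} → u ∈ vis → Adj G u w → w ∈ vis
        visited {u} {w} u∈ uw with u Fin.≟ v | w ∈? vis
        ... | _        | yes w∈ = w∈
        ... | no u≢v   | no _   = sat u∈ u≢v uw
        ... | yes refl | no w∉  = contradiction (w , uw , w∉) none
      growAll conn zero vis enough un v∈ C⊆ sat | yes (y , vy , y∉) =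
        contradiction enough (ℕₚ.<⇒≱ (Unique-length≤ {l = y ∷ vis} (Allₚ.¬Any⇒All¬ vis y∉ ∷ un)))
      growAll conn (suc fuel) vis enough un v∈ C⊆ sat | yes (y , vy , y∉) = record
        { arms      = t ∷ R.arms
        ; uniq      = Uniqueₚ.++⁺ T.uniq R.uniq (λ (u∈t , u∈R) → R.fresh u∈R (∈-++⁺ˡ u∈t))
        ; fresh     = λ u∈ → [ T.fresh , (λ u∈R u∈vis → R.fresh u∈R (∈-++⁺ʳ t u∈vis)) ]′ (∈-++⁻ t u∈)
        ; adjacent  = λ e∈ → [ T.adjacent , R.adjacent ]′ (∈-++⁻ (pairs (v ∷ t)) e∈)
        ; saturated = λ u∈ uw → [ (λ u∈t → Sum.map ∈-++⁺ˡ ∈-++⁺ˡ (T.saturated u∈t uw))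
                                , (λ u∈R → Sum.map (∈-++⁺ʳ (pairs (v ∷ t))) (∈-++⁺ʳ (pairs (v ∷ t))) (R.saturated u∈R uw)) ]′ (∈-++⁻ t u∈)
        ; nonempty  = s≤s z≤n ∷ R.nonempty
        ; exhausts  = λ u → [ (λ u∈ → [ inj₂ ∘ ∈-++⁺ˡ , inj₁ ]′ (∈-++⁻ t u∈)) , inj₂ ∘ ∈-++⁺ʳ t ]′ (R.exhausts u)
        }
        where
        v≢y : v ≢ y
        v≢y refl = y∉ v∈
        first : Tentacle vis v y
        first = grow n vis v y [] (ℕₚ.m≤m+n n (length vis)) un v∈ C⊆ y∉ v∈ vy (λ u∈ u≢v uw → inj₁ (sat u∈ u≢v uw))
          ((v≢y ∷ []) ∷ [] ∷ []) (Adj-sym vy ∷ [-]) (λ ()) (λ _ → refl)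
        module T = Tentacle first
        t = y ∷ T.tail
        enough′ : n ≤ fuel ℕ.+ length (t ++ vis)
        enough′ = begin
          n                                ≤⟨ enough ⟩
          suc fuel ℕ.+ length vis          ≡⟨ ℕₚ.+-suc fuel (length vis) ⟨
          fuel ℕ.+ suc (length vis)        ≤⟨ ℕₚ.+-monoʳ-≤ fuel (s≤s (ℕₚ.m≤n+m (length vis) (length T.tail))) ⟩
          fuel ℕ.+ (length t ℕ.+ length vis) ≡⟨ cong (ℕ._+_ fuel) (Listₚ.length-++ t) ⟨
          fuel ℕ.+ length (t ++ vis)       ∎
          where open ℕₚ.≤-Reasoning
        in-v∷t : ∀ {w} → w ∈ v ∷ t → w ∈ t ++ vis
        in-v∷t (here refl) = ∈-++⁺ʳ t v∈
        in-v∷t (there w∈)  = ∈-++⁺ˡ w∈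
        sat′ : ∀ {u w} → u ∈ t ++ vis → u ≢ v → Adj G u w → w ∈ t ++ vis
        sat′ u∈ u≢v uw with ∈-++⁻ t u∈
        ... | inj₂ u∈vis = ∈-++⁺ʳ t (sat u∈vis u≢v uw)
        ... | inj₁ u∈t   = in-v∷t ([ proj₂ ∘ ∈-pairs⁻ (v ∷ t) , proj₁ ∘ ∈-pairs⁻ (v ∷ t) ]′ (T.saturated u∈t uw))
        module R = Tentacles (growAll conn fuel (t ++ vis) enough′
          (Uniqueₚ.++⁺ T.uniq un (λ (u∈t , u∈vis) → T.fresh u∈t u∈vis)) (∈-++⁺ʳ t v∈) (∈-++⁺ʳ t ∘ C⊆) sat′)

∈-closed⁻ : {s u : A} {l : List A} → u ∈ s ∷ l ++ [ s ] → u ∈ s ∷ l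
∈-closed⁻ {s = s} {l = l} u∈ with ∈-++⁻ (s ∷ l) u∈
... | inj₁ u∈′         = u∈′
... | inj₂ (here refl) = here refl

squid-decomposition : ∀ {n} (G : Graph n) → Squid G → Decomposition G
squid-decomposition {n} G (conn , (c , same) , v , _ , only) with rotate v∈C
  where
  open import Data.List.Membership.DecPropositional (Fin._≟_ {n}) using (_∈?_)
  saturatedC : v ∉ start c ∷ rest c → ∀ {u w} → u ∈ start c ∷ rest c → Adj G u w → w ∈ start c ∷ rest c
  saturatedC v∉ u∈ uw = ∈-closed⁻ ([ proj₂ ∘ ∈-pairs⁻ (start c ∷ rest c ++ [ start c ]) , proj₁ ∘ ∈-pairs⁻ (start c ∷ rest c ++ [ start c ]) ]′
    (closed-saturated G v only (distinct c) (long c) (Linked⁻ (closed c)) u∈ (λ { refl → v∉ u∈ }) uw))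
  -- If `v` were off the cycle, no edge would leave the cycle, yet a walk leads from it to `v`.
  v∈C : v ∈ start c ∷ rest c
  v∈C with v ∈? (start c ∷ rest c)
  ... | yes v∈ = v∈
  ... | no v∉  = walk-invariant G (saturatedC v∉) (here refl) (conn (start c) v)
... | ys , perm , permE = record
  { root      = v
  ; arc       = ys
  ; tentacles = S.arms
  ; unique    = Uniqueₚ.++⁺ un S.uniq (λ (u∈ , u∈S) → S.fresh u∈S u∈)
  ; complete  = λ u → [ ∈-++⁺ˡ , ∈-++⁺ʳ (v ∷ ys) ]′ (S.exhausts u)
  ; sound     = λ e∈ → [ adjacentC , S.adjacent ]′ (∈-++⁻ E e∈)
  ; covering  = covering
  ; arc-long  = ys-long
  ; nonempty  = S.nonempty
  }
  where
  E = pairs (v ∷ ys ++ [ v ])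
  un : Unique (v ∷ ys)
  un = Unique-resp-↭ perm (distinct c)
  ys-long : 2 ≤ length ys
  ys-long = subst (2 ≤_) (ℕₚ.suc-injective (↭ₚ.↭-length perm)) (long c)
  adjacentC : ∀ {u w} → (u , w) ∈ E → Adj G u w
  adjacentC e∈ = Linked⁻ (closed c) (↭ₚ.∈-resp-↭ (↭-sym permE) e∈)
  saturatedC : ∀ {u w} → u ∈ v ∷ ys → u ≢ v → Adj G u w → (u , w) ∈ E ⊎ (w , u) ∈ E
  saturatedC = closed-saturated G v only un ys-long adjacentC
  in-cycle : ∀ {x y} → Consec (start c ∷ rest c ++ [ start c ]) x y → x ∈ start c ∷ rest c × y ∈ start c ∷ rest c
  in-cycle (xs , zs , eq) =
    ∈-closed⁻ (subst (_ ∈_) (sym eq) (∈-++⁺ʳ xs (here refl))) , ∈-closed⁻ (subst (_ ∈_) (sym eq) (∈-++⁺ʳ xs (there (here refl))))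
  no-return : ∀ {u x l} → Unique (v ∷ u ∷ x ∷ l) → Linked (Adj G) (u ∷ x ∷ l ++ [ v ]) → Adj G v u → u ∈ start c ∷ rest c
  -- The path from `u` back to `v` closes up to a cycle `d`. It has the same edges as `c`, and the
  -- edge from `v` to `u` is one of them.
  no-return {u} {x} {l} unD linked vu = [ proj₂ ∘ in-cycle , proj₁ ∘ in-cycle ]′ (proj₂ (same c d v u) (inj₁ ([] , x ∷ l ++ [ v ] , refl)))
    where
    d : Cycle G
    d = record { start = v ; rest = u ∷ x ∷ l ; long = s≤s (s≤s z≤n) ; distinct = unD ; closed = vu ∷ linked }
  module S = Tentacles (growAll G v only (start c ∷ rest c) no-return conn n (v ∷ ys) (ℕₚ.m≤m+n n _) un (here refl) (↭ₚ.∈-resp-↭ perm)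
    (λ u∈ u≢v uw → ∈-closed⁻ ([ proj₂ ∘ ∈-pairs⁻ (v ∷ ys ++ [ v ]) , proj₁ ∘ ∈-pairs⁻ (v ∷ ys ++ [ v ]) ]′ (saturatedC u∈ u≢v uw))))
  covering-from : ∀ {u w} → u ≢ v → Adj G u w → (u , w) ∈ edges v ys S.arms ⊎ (w , u) ∈ edges v ys S.arms
  covering-from {u} u≢v uw with S.exhausts u
  ... | inj₁ u∈ = Sum.map ∈-++⁺ˡ ∈-++⁺ˡ (saturatedC u∈ u≢v uw)
  ... | inj₂ u∈ = Sum.map (∈-++⁺ʳ E) (∈-++⁺ʳ E) (S.saturated u∈ uw)
  covering : ∀ {u w} → Adj G u w → (u , w) ∈ edges v ys S.arms ⊎ (w , u) ∈ edges v ys S.arms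
  covering {u} {w} uw with u Fin.≟ v
  ... | no u≢v   = covering-from u≢v uw
  ... | yes refl = Sum.swap (covering-from (λ { refl → Adj-irrefl G uw }) (Adj-sym G uw))

-- Isomorphism of graphs with decompositions of the same shape

concat-↭ : {xss yss : List (List A)} → xss ↭ yss → concat xss ↭ concat yss
concat-↭ ↭.refl           = ↭.refl
concat-↭ (↭.prep xs p)    = ↭ₚ.++⁺ˡ xs (concat-↭ p)
concat-↭ (↭.swap xs ys p) = ↭.trans (↭ₚ.shifts xs ys) (↭ₚ.++⁺ˡ ys (↭ₚ.++⁺ˡ xs (concat-↭ p)))
concat-↭ (↭.trans p q)    = ↭.trans (concat-↭ p) (concat-↭ q)

-- The symmetric function yields the tentacle lengths only as a multiset, whereas `shape-≅` compares
-- lists; reordering bridges the two.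
permute-tentacles : ∀ {n} {G : Graph n} (D : Decomposition G) {ts : List (List (Fin n))} →
  Decomposition.tentacles D ↭ ts → Decomposition G
permute-tentacles D {ts} p = record
  { root      = root
  ; arc       = arc
  ; tentacles = ts
  ; unique    = Unique-resp-↭ vertices↭ unique
  ; complete  = ↭ₚ.∈-resp-↭ vertices↭ ∘ complete
  ; sound     = sound ∘ ↭ₚ.∈-resp-↭ (↭-sym edges↭)
  ; covering  = Sum.map (↭ₚ.∈-resp-↭ edges↭) (↭ₚ.∈-resp-↭ edges↭) ∘ covering
  ; arc-long  = arc-long
  ; nonempty  = ↭ₚ.All-resp-↭ p nonempty
  }
  where
  open Decomposition D
  vertices↭ : vertices ↭ root ∷ concat (arc ∷ ts)
  vertices↭ = ↭.prep root (↭ₚ.++⁺ˡ arc (concat-↭ p))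
  edges↭ : edges root arc tentacles ↭ edges root arc ts
  edges↭ = ↭ₚ.++⁺ˡ (pairs (root ∷ arc ++ [ root ])) (concat-↭ (↭ₚ.map⁺ (λ t → pairs (root ∷ t)) p))

shape : ∀ {n} {G : Graph n} → Decomposition G → List ℕ
shape D = map length (Decomposition.arc D ∷ Decomposition.tentacles D)

module _ {n m} {G : Graph n} {H : Graph m} (D : Decomposition G) (D′ : Decomposition H) where
  private
    module D  = Decomposition D
    module D′ = Decomposition D′

  -- The two vertex lists are matched position by position, which carries one edge list to the
  -- other. One direction is enough: exchanging the decompositions gives the inverse map and the
  -- converse for adjacency.
  shape-map : shape D ≡ shape D′ → ∃[ φ ] (map φ D.vertices ≡ D′.vertices × (∀ {u w} → Adj G u w → Adj H (φ u) (φ w)))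
  shape-map shape≡ = φ , φ-vertices , adjacent
    where
    lengths : length D′.vertices ≡ length D.vertices
    lengths = cong suc (trans (length-concat (D′.arc ∷ D′.tentacles))
      (trans (cong sum (sym shape≡)) (sym (length-concat (D.arc ∷ D.tentacles)))))
    assigned = assignment D.vertices D.unique D′.vertices lengths D′.root
    φ = proj₁ assigned
    φ-vertices = proj₂ assigned
    φ-lists : map (map φ) (D.arc ∷ D.tentacles) ≡ D′.arc ∷ D′.tentacles
    φ-lists = begin
      map (map φ) ls
        ≡⟨ chop-concat (map (map φ) ls) ⟨
      chop (map length (map (map φ) ls)) (concat (map (map φ) ls))
        ≡⟨ cong₂ chop (trans (sym (Listₚ.map-∘ ls)) (Listₚ.map-cong (Listₚ.length-map φ) ls)) (Listₚ.concat-map ls) ⟩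
      chop (shape D) (map φ (concat ls))
        ≡⟨ cong₂ chop shape≡ (Listₚ.∷-injectiveʳ φ-vertices) ⟩
      chop (shape D′) (concat (D′.arc ∷ D′.tentacles))
        ≡⟨ chop-concat (D′.arc ∷ D′.tentacles) ⟩
      D′.arc ∷ D′.tentacles ∎
      where
      open ≡-Reasoning
      ls = D.arc ∷ D.tentacles
    φ-edges : map (mapPair φ) (edges D.root D.arc D.tentacles) ≡ edges D′.root D′.arc D′.tentacles
    φ-edges = trans (map-edges φ D.root D.arc D.tentacles) (trans
      (cong (λ v → edges v (map φ D.arc) (map (map φ) D.tentacles)) (Listₚ.∷-injectiveˡ φ-vertices))
      (cong₂ (edges D′.root) (Listₚ.∷-injectiveˡ φ-lists) (Listₚ.∷-injectiveʳ φ-lists)))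
    edge : ∀ {u w} → (u , w) ∈ edges D.root D.arc D.tentacles → Adj H (φ u) (φ w)
    edge {u} {w} e∈ = D′.sound (subst ((φ u , φ w) ∈_) φ-edges (∈-map⁺ (mapPair φ) e∈))
    adjacent : ∀ {u w} → Adj G u w → Adj H (φ u) (φ w)
    adjacent uw = [ edge , Adj-sym H ∘ edge ]′ (D.covering uw)

shape-≅ : ∀ {n m} {G : Graph n} {H : Graph m} (D : Decomposition G) (D′ : Decomposition H) →
  length (Decomposition.arc D) ≡ length (Decomposition.arc D′) →
  map length (Decomposition.tentacles D) ≡ map length (Decomposition.tentacles D′) → G ≅ H
shape-≅ {G = G} {H} D D′ arc≡ ts≡ with shape-map D D′ (cong₂ _∷_ arc≡ ts≡) | shape-map D′ D (sym (cong₂ _∷_ arc≡ ts≡))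
... | φ , φ-vertices , φ-adj | ψ , ψ-vertices , ψ-adj = mk↔ₛ′ φ ψ φψ ψφ ,
  λ u w → Bool-ext (λ adj → subst₂ (Adj G) (ψφ u) (ψφ w) (ψ-adj adj)) φ-adj
  where
  open Decomposition
  inverse : ∀ {k l} {L : List (Fin k)} {L′ : List (Fin l)} {f : Fin k → Fin l} {g : Fin l → Fin k} →
    map f L ≡ L′ → map g L′ ≡ L → ∀ {u} → u ∈ L → g (f u) ≡ u
  inverse {L = L} refl eq = map-agree (trans (Listₚ.map-∘ L) (trans eq (sym (Listₚ.map-id L))))
  φψ : ∀ u → φ (ψ u) ≡ u
  φψ u = inverse ψ-vertices φ-vertices (complete D′ u)
  ψφ : ∀ u → ψ (φ u) ≡ u
  ψφ u = inverse φ-vertices ψ-vertices (complete D u)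

-- From equal symmetric functions to an isomorphism

module _ {n m} {G : Graph n} {H : Graph m} (D : Decomposition G) (D′ : Decomposition H) (sameX : SameX G H) where
  open Decomposition D
  open Decomposition D′ using () renaming (arc to arc′; tentacles to tentacles′; nonempty to nonempty′)
  private
    ns  = map length tentacles
    ns′ = map length tentacles′

  sameSums : SameSums (length arc) ns (length arc′) ns′
  sameSums q f = ℤₚ.*-cancelˡ-≡ (ℤ.+ suc q) _ _ (trans (sym (weightedCount-rootedSum (suc q) D f))
    (trans (SameX⇒weightedCount G H sameX (double (suc q)) (λ c → wt (group c)) f) (weightedCount-rootedSum (suc q) D′ f)))

  arcs≡ : length arc ≡ length arc′
  arcs≡ = sameGirth (length arc) ns (length arc′) ns′ sameSums (ℕₚ.≤-trans (s≤s z≤n) arc-long)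

  sums≡ : sum ns ≡ sum ns′
  sums≡ = ℕₚ.+-cancelˡ-≡ (length arc) _ _ (trans
    (sameOrder (length arc) ns (length arc′) ns′ sameSums (ℕₚ.≤-trans (s≤s z≤n) arc-long))
    (cong (ℕ._+ sum ns′) (sym arcs≡)))

  lengths↭ : ns ↭ ns′
  lengths↭ = go (length arc) refl arc-long
    where
    -- The arc length is replaced by a variable so that matching exposes the successor that
    -- `sameLonger` is stated for.
    go : ∀ ℓ → ℓ ≡ length arc → 2 ≤ ℓ → ns ↭ ns′
    go (suc ℓ) eq 2≤ℓ = longer⇒↭ (Allₚ.map⁺ nonempty) (Allₚ.map⁺ nonempty′)
      (folded⇒longer ns ns′ small (subst (λ s → suc (suc s) ≤ suc (suc ℓ ℕ.+ sum ns)) sums≡ small)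
        (sameLonger ℓ ns ns′ same sums≡))
      where
      same : SameSums (suc ℓ) ns (suc ℓ) ns′
      same = subst₂ (λ x y → SameSums x ns y ns′) (sym eq) (trans (sym arcs≡) (sym eq)) sameSums
      small : suc (suc (sum ns)) ≤ suc (suc ℓ ℕ.+ sum ns)
      small = s≤s (s≤s (ℕₚ.m≤n+m (sum ns) ℓ))

  decompositions-≅ : G ≅ H
  decompositions-≅ with ↭ₚ.↭-map-inv length lengths↭
  ... | ts , ts≡ , p = shape-≅ (permute-tentacles D p) D′ arcs≡ (sym ts≡)

theorem5p1 : ∀ {n m : ℕ} (G : Graph n) (H : Graph m) →
    Squid G → Squid H → SameX G H → G ≅ H
theorem5p1 G H squidG squidH = decompositions-≅ (squid-decomposition G squidG) (squid-decomposition H squidH)
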